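{- Let $G=(V(G),E(G),r(G))$ be a simple rooted graph, let $r=r(G)$, let $L_r(G)=\{v\in V(G)\setminus\{r\}: rv\in E(G),\ d_G(v)=1\}$, and let $\ell_r(G)=|L_r(G)|$. Then $$\operatorname{ord}_{x}T(\Gamma(G);x,y)=\ell_r(G),$$ where $\operatorname{ord}_{x}T(\Gamma(G);x,y)=\max\{a\in\mathbb Z_{\geq0}:x^a\mid T(\Gamma(G);x,y)\}$, divisibility being in $\mathbb Z[x,y]$.
   Context: All graphs are finite. A simple graph has no loops and no multiple edges; it need not be connected. $d_G(v)$ is the degree of $v$ in $G$. A rooted graph $G=(V(G),E(G),r(G))$ is a graph with a distinguished vertex $r(G)$, called the root. For $A\subseteq E(G)$, let $G|A=(V(G),A,r(G))$ be the rooted spanning subgraph with edge set $A$, and let $C_G(A)$ be the connected component of $G|A$ containing $r(G)$. The set $A$ is feasible if $C_G(A)$ is a tree and contains all edges of $A$. Let $\mathcal F(G)$ be the family of feasible sets and $\Gamma(G)=(E(G),\mathcal F(G))$ the greedoid induced by $G$. Its rank function is $\rho_{\Gamma(G)}(A)=\max\{|A'|:A'\subseteq A,\ A'\in\mathcal F(G)\}$ and $\rho(\Gamma(G))=\rho_{\Gamma(G)}(E(G))$. The greedoid Tutte polynomial is $$T(\Gamma(G);x,y)=\sum_{A\subseteq E(G)}(x-1)^{\rho(\Gamma(G))-\rho_{\Gamma(G)}(A)}(y-1)^{|A|-\rho_{\Gamma(G)}(A)},$$ which is a nonzero polynomial in $\mathbb Z[x,y]$. -}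

module Defs where

open import Level using (0ℓ; Level)
open import Algebra.Bundles.Raw using (RawRing)
import Algebra.Definitions.RawSemiring as RawSemiringDefinitions
open import Data.Empty using (⊥; ⊥-elim)
open import Data.Fin.Base as Fin using (Fin; toℕ; fromℕ<)
import Data.Fin.Properties as Fin
open import Data.Fin.Subset using (Subset; inside; outside; _∈_; _⊆_; ∣_∣)
  renaming (⊤ to full)
open import Data.Fin.Subset.Properties using (_∈?_; _⊆?_)
open import Data.Integer.Base using (+-*-rawRing)
open import Data.List.Base
  using (List; []; _∷_; _++_; map; filter; foldr; length; lookup; allFin)
open import Data.List.Extrema.Nat using (max)
open import Data.List.Relation.Unary.Linked using (Linked; linked?)
open import Data.List.Relation.Unary.Unique.Propositional using (Unique)
import Data.List.Relation.Unary.All as All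
open import Data.List.Relation.Unary.AllPairs.Core using (_∷_)
import Data.List.Relation.Unary.Unique.DecPropositional as Unique
open import Data.List.Membership.Propositional.Properties using (∈-lookup)
open import Data.Nat.Base using (ℕ; zero; suc; _∸_; _≤_; _<_; z≤n; s≤s)
import Data.Nat.Properties as ℕ
open import Data.Product.Base using (∃; _×_; _,_; proj₁; proj₂)
open import Data.Product.Properties using (≡-dec)
open import Data.Sum.Base using (_⊎_; inj₁; inj₂)
open import Data.Unit.Base using (⊤; tt)
import Data.Vec.Base as Vec
open import Function.Base using (_∘_)
open import Relation.Binary.Construct.Closure.ReflexiveTransitive
  using (Star; ε; _◅_; _◅◅_)
open import Relation.Binary.Core using (Rel)
import Relation.Binary.Definitions as Binary
open import Relation.Binary.PropositionalEquality
  using (_≡_; _≢_; refl; sym; cong; subst)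
open import Relation.Nullary.Decidable
  using (Dec; yes; no; map′; ¬?; _×-dec_; _⊎-dec_; _→-dec_)
open import Relation.Nullary.Negation.Core using (¬_)
open import Relation.Unary using (Pred; Decidable)

module _ {n : ℕ} {R : Rel (Fin n) 0ℓ} (R? : Binary.Decidable R) where

  private

    -- Paths whose interior vertices are all smaller than k (Warshall).
    Path : ∀ k → k ≤ n → Rel (Fin n) 0ℓ
    Path zero    _   u v = u ≡ v ⊎ R u v
    Path (suc k) k<n u v =
      Path k (ℕ.<⇒≤ k<n) u v ⊎
      (Path k (ℕ.<⇒≤ k<n) u (fromℕ< k<n) ×
       Path k (ℕ.<⇒≤ k<n) (fromℕ< k<n) v)

    path? : ∀ k k≤n → Binary.Decidable (Path k k≤n)
    path? zero    _   u v = (u Fin.≟ v) ⊎-dec R? u v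
    path? (suc k) k<n u v =
      path? k _ u v ⊎-dec (path? k _ u _ ×-dec path? k _ _ v)

    sound : ∀ k k≤n {u v} → Path k k≤n u v → Star R u v
    sound zero    _   (inj₁ refl)    = ε
    sound zero    _   (inj₂ r)       = r ◅ ε
    sound (suc k) k<n (inj₁ p)       = sound k _ p
    sound (suc k) k<n (inj₂ (p , q)) = sound k _ p ◅◅ sound k _ q

    base : ∀ k k≤n {u v} → u ≡ v ⊎ R u v → Path k k≤n u v
    base zero    _ b = b
    base (suc k) _ b = inj₁ (base k _ b)

    join : ∀ k k≤n {u w v} → toℕ w < k →
           Path k k≤n u w → Path k k≤n w v → Path k k≤n u v
    join (suc k) k<n {u} {w} {v} (s≤s w≤k) p q with ℕ.m≤n⇒m<n∨m≡n w≤k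
    ... | inj₂ refl = inj₂ (toHub p , fromHub q)
      where
      hub : fromℕ< k<n ≡ w
      hub = Fin.fromℕ<-toℕ w k<n
      toHub : Path (suc k) k<n u w → Path k (ℕ.<⇒≤ k<n) u (fromℕ< k<n)
      toHub (inj₁ a)       = subst (Path k (ℕ.<⇒≤ k<n) u) (sym hub) a
      toHub (inj₂ (a , _)) = a
      fromHub : Path (suc k) k<n w v → Path k (ℕ.<⇒≤ k<n) (fromℕ< k<n) v
      fromHub (inj₁ a)       = subst (λ h → Path k (ℕ.<⇒≤ k<n) h v) (sym hub) a
      fromHub (inj₂ (_ , a)) = a
    ... | inj₁ w<k with p | q
    ...   | inj₁ a       | inj₁ b       = inj₁ (join k _ w<k a b)
    ...   | inj₁ a       | inj₂ (b , c) = inj₂ (join k _ w<k a b , c)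
    ...   | inj₂ (a , b) | inj₁ c       = inj₂ (a , join k _ w<k b c)
    ...   | inj₂ (a , _) | inj₂ (_ , b) = inj₂ (a , b)

    complete : ∀ {u v} → Star R u v → Path n ℕ.≤-refl u v
    complete ε                  = base n _ (inj₁ refl)
    complete (_◅_ {j = w} r rs) =
      join n _ (Fin.toℕ<n w) (base n _ (inj₂ r)) (complete rs)

  star? : Binary.Decidable (Star R)
  star? u v = map′ (sound n _) complete (path? n ℕ.≤-refl u v)

module _ {n : ℕ} where

  private

    anyShort? : ∀ k {P : Pred (List (Fin n)) 0ℓ} → Decidable P →
                Dec (∃ λ vs → length vs ≤ k × P vs)
    anyShort? zero {P} P? = map′ to from (P? [])
      where
      to : P [] → _
      to p = [] , z≤n , p
      from : (∃ λ vs → length vs ≤ 0 × P vs) → P []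
      from ([] , _ , p) = p
    anyShort? (suc k) {P} P? =
      map′ to from (P? [] ⊎-dec Fin.any? λ v → anyShort? k (P? ∘ (v ∷_)))
      where
      Cons : Set
      Cons = ∃ λ v → ∃ λ vs → length vs ≤ k × P (v ∷ vs)
      to : P [] ⊎ Cons → ∃ λ vs → length vs ≤ suc k × P vs
      to (inj₁ p)                = [] , z≤n , p
      to (inj₂ (v , vs , l , p)) = v ∷ vs , s≤s l , p
      from : (∃ λ vs → length vs ≤ suc k × P vs) → P [] ⊎ Cons
      from ([]     , _     , p) = inj₁ p
      from (v ∷ vs , s≤s l , p) = inj₂ (v , vs , l , p)

    lookup-injective : ∀ {vs : List (Fin n)} → Unique vs →
                       ∀ {i j} → lookup vs i ≡ lookup vs j → i ≡ j
    lookup-injective (v∉ ∷ u) {Fin.zero}  {Fin.zero}  eq = refl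
    lookup-injective (v∉ ∷ u) {Fin.zero}  {Fin.suc j} eq =
      ⊥-elim (All.lookup v∉ (∈-lookup j) eq)
    lookup-injective (v∉ ∷ u) {Fin.suc i} {Fin.zero}  eq =
      ⊥-elim (All.lookup v∉ (∈-lookup i) (sym eq))
    lookup-injective (v∉ ∷ u) {Fin.suc i} {Fin.suc j} eq =
      cong Fin.suc (lookup-injective u eq)

  anyUnique? : {P : Pred (List (Fin n)) 0ℓ} → Decidable P →
               (∀ {vs} → P vs → Unique vs) → Dec (∃ P)
  anyUnique? P? unique = map′
    (λ (vs , _ , p) → vs , p)
    (λ (vs , p) → vs , Fin.injective⇒≤ (lookup-injective (unique p)) , p)
    (anyShort? n P?)

-- A finite simple graph, with vertices and edges numbered, and a root.
-- An edge is stored as an ordered pair of ends, whose order carries no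
-- meaning: everything below refers to it through Joins or Incident.

record SimpleRootedGraph : Set where
  field
    #V #E : ℕ
    ends  : Fin #E → Fin #V × Fin #V
    root  : Fin #V

  Joins : Fin #E → Rel (Fin #V) 0ℓ
  Joins e u v = ends e ≡ (u , v) ⊎ ends e ≡ (v , u)

  field
    noLoops    : ∀ {e v} → ¬ Joins e v v
    noParallel : ∀ {e f u v} → Joins e u v → Joins f u v → e ≡ f

module _ (G : SimpleRootedGraph) where

  open SimpleRootedGraph G

  Vertex Edge : Set
  Vertex = Fin #V
  Edge   = Fin #E

  Incident : Edge → Vertex → Set
  Incident e v = proj₁ (ends e) ≡ v ⊎ proj₂ (ends e) ≡ v

  record Subgraph : Set₁ where
    field
      VertexIn : Pred Vertex 0ℓ
      EdgeIn   : Pred Edge 0ℓ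
      closed   : ∀ {e v} → EdgeIn e → Incident e v → VertexIn v

  open Subgraph

  Adjacent : Subgraph → Rel Vertex 0ℓ
  Adjacent H u v = ∃ λ e → EdgeIn H e × Joins e u v

  Reachable : Subgraph → Rel Vertex 0ℓ
  Reachable H = Star (Adjacent H)

  Connected : Subgraph → Set
  Connected H = ∀ {u v} → VertexIn H u → VertexIn H v → Reachable H u v

  -- The cyclic vertex sequence of a cycle of length 1 + length vs.
  -- Since G is simple, every cycle has length at least 3 and is
  -- determined by its vertices.
  IsCycle : Subgraph → List Vertex → Set
  IsCycle H []       = ⊥
  IsCycle H (v ∷ vs) =
    2 ≤ length vs × Unique (v ∷ vs) × Linked (Adjacent H) (v ∷ vs ++ v ∷ [])

  Acyclic : Subgraph → Set
  Acyclic H = ¬ ∃ (IsCycle H)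

  IsTree : Subgraph → Set
  IsTree H = Connected H × Acyclic H

  component : Subgraph → Vertex → Subgraph
  component H w = record
    { VertexIn = Reachable H w
    ; EdgeIn   = λ e → EdgeIn H e × (∀ v → Incident e v → Reachable H w v)
    ; closed   = λ (_ , reach) → reach _
    }

  spanning : Subset #E → Subgraph
  spanning A = record
    { VertexIn = λ _ → ⊤
    ; EdgeIn   = _∈ A
    ; closed   = λ _ _ → tt
    }

  rootComponent : Subset #E → Subgraph
  rootComponent A = component (spanning A) root

  Feasible : Subset #E → Set
  Feasible A =
    IsTree (rootComponent A) × (∀ e → e ∈ A → EdgeIn (rootComponent A) e)

  joins? : ∀ e → Binary.Decidable (Joins e)
  joins? e u v = (ends e ≟ (u , v)) ⊎-dec (ends e ≟ (v , u))
    where _≟_ = ≡-dec Fin._≟_ Fin._≟_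

  incident? : ∀ e → Decidable (Incident e)
  incident? e v = (proj₁ (ends e) Fin.≟ v) ⊎-dec (proj₂ (ends e) Fin.≟ v)

  module _ (H : Subgraph) (edge? : Decidable (EdgeIn H)) where

    adjacent? : Binary.Decidable (Adjacent H)
    adjacent? u v = Fin.any? λ e → edge? e ×-dec joins? e u v

    reachable? : Binary.Decidable (Reachable H)
    reachable? = star? adjacent?

    connected? : Decidable (VertexIn H) → Dec (Connected H)
    connected? vertex? = map′ (λ c {u} {v} → c u v) (λ c u v → c)
      (Fin.all? λ u → Fin.all? λ v →
        vertex? u →-dec (vertex? v →-dec reachable? u v))

    isCycle? : Decidable (IsCycle H)
    isCycle? []       = no λ ()
    isCycle? (v ∷ vs) =
      (2 ℕ.≤? length vs) ×-dec
      (Unique.unique? Fin._≟_ (v ∷ vs) ×-dec linked? adjacent? _)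

    acyclic? : Dec (Acyclic H)
    acyclic? = ¬? (anyUnique? isCycle? λ { {_ ∷ _} (_ , u , _) → u })

    isTree? : Decidable (VertexIn H) → Dec (IsTree H)
    isTree? vertex? = connected? vertex? ×-dec acyclic?

    componentEdge? : ∀ w → Decidable (EdgeIn (component H w))
    componentEdge? w e =
      edge? e ×-dec Fin.all? λ v → incident? e v →-dec reachable? w v

  feasible? : Decidable Feasible
  feasible? A =
    isTree? (rootComponent A) edge? (reachable? (spanning A) (_∈? A) root)
    ×-dec Fin.all? (λ e → (e ∈? A) →-dec edge? e)
    where
    edge? : Decidable (EdgeIn (rootComponent A))
    edge? = componentEdge? (spanning A) (_∈? A) root

  Adj : Rel Vertex 0ℓ
  Adj = Adjacent (spanning full)

  degree : Vertex → ℕ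
  degree v = length (filter (λ e → incident? e v) (allFin #E))

  IsRootLeaf : Pred Vertex 0ℓ
  IsRootLeaf v = v ≢ root × Adj root v × degree v ≡ 1

  isRootLeaf? : Decidable IsRootLeaf
  isRootLeaf? v =
    ¬? (v Fin.≟ root) ×-dec
    (adjacent? (spanning full) (_∈? full) root v ×-dec (degree v ℕ.≟ 1))

  #rootLeaves : ℕ
  #rootLeaves = length (filter isRootLeaf? (allFin #V))

subsets : ∀ n → List (Subset n)
subsets zero    = Vec.[] ∷ []
subsets (suc n) =
  map (outside Vec.∷_) (subsets n) ++ map (inside Vec.∷_) (subsets n)

-- The empty set is feasible, so the default value 0 of max has no effect.
rank : (G : SimpleRootedGraph) → Subset (SimpleRootedGraph.#E G) → ℕ
rank G A =
  max 0 (map ∣_∣ (filter (λ A′ → (A′ ⊆? A) ×-dec feasible? G A′)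
                         (subsets (SimpleRootedGraph.#E G))))

-- R[X] as lists of coefficients, constant term first. Trailing zeros are
-- allowed: equality compares the coefficients of every power of X.

module Polynomial {c ℓ : Level} (R : RawRing c ℓ) where

  open RawRing R

  Poly : Set c
  Poly = List Carrier

  coeff : Poly → ℕ → Carrier
  coeff []      _       = 0#
  coeff (a ∷ _) zero    = a
  coeff (_ ∷ p) (suc k) = coeff p k

  infix  4 _≈ₚ_
  infixl 6 _+ₚ_
  infixl 7 _*ₚ_

  _≈ₚ_ : Rel Poly ℓ
  p ≈ₚ q = ∀ k → coeff p k ≈ coeff q k

  _+ₚ_ : Poly → Poly → Poly
  []      +ₚ q       = q
  (a ∷ p) +ₚ []      = a ∷ p
  (a ∷ p) +ₚ (b ∷ q) = (a + b) ∷ (p +ₚ q)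

  _*ₚ_ : Poly → Poly → Poly
  []      *ₚ q = []
  (a ∷ p) *ₚ q = map (a *_) q +ₚ (0# ∷ (p *ₚ q))

  polynomialRing : RawRing c ℓ
  polynomialRing = record
    { Carrier = Poly
    ; _≈_     = _≈ₚ_
    ; _+_     = _+ₚ_
    ; _*_     = _*ₚ_
    ; -_      = map (-_)
    ; 0#      = []
    ; 1#      = 1# ∷ []
    }

  const : Carrier → Poly
  const a = a ∷ []

  X : Poly
  X = 0# ∷ 1# ∷ []

ℤ[y] : RawRing 0ℓ 0ℓ
ℤ[y] = Polynomial.polynomialRing +-*-rawRing

-- ℤ[x , y] is built as (ℤ[y])[x].
ℤ[x,y] : RawRing 0ℓ 0ℓ
ℤ[x,y] = Polynomial.polynomialRing ℤ[y]

open RawRing ℤ[x,y] using (rawSemiring; _+_; _*_; -_; 0#; 1#)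
  renaming (Carrier to ℤ[x,y]-Carrier)
open RawSemiringDefinitions rawSemiring using (_^_; _∣_)

x y : ℤ[x,y]-Carrier
x = Polynomial.X ℤ[y]
y = Polynomial.const ℤ[y] (Polynomial.X +-*-rawRing)

-- Both truncated subtractions are exact: rank G A is at most rank G full
-- and at most ∣ A ∣.
tutte : SimpleRootedGraph → ℤ[x,y]-Carrier
tutte G = foldr _+_ 0# (map term (subsets #E))
  where
  open SimpleRootedGraph G using (#E)
  term : Subset #E → ℤ[x,y]-Carrier
  term A = (x + - 1#) ^ (rank G full ∸ rank G A)
         * (y + - 1#) ^ (∣ A ∣ ∸ rank G A)

IsMaximum : Pred ℕ 0ℓ → ℕ → Set
IsMaximum P m = P m × (∀ a → P a → a ≤ m)

-- The zero polynomial is divisible by every power of x, so the order is not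
-- a total function; it is given by its graph.
IsOrdₓ : ℤ[x,y]-Carrier → ℕ → Set
IsOrdₓ p m = IsMaximum (λ a → (x ^ a) ∣ p) m

{-# OPTIONS --safe #-}
module Submission where

-- The rank of A is the number ρ A of non-root vertices reached from the root
-- along A.  A root leaf contributes a factor x, so it remains to see that
-- T(0, y) ≠ 0 when there is no root leaf.  Up to sign and a power of t,
-- T(0, 1 + 1/t) is the integer Σ (−1)^ρ(A) t^(∣E∣ − ∣A∣ + ρ(A)), which is
-- multiplicative over edge sets meeting only in the root; so let the edge set
-- be irreducible, with root edges R and other edges N, and put k = ∣R∣, n = ρ(E).
-- Writing A = M ∪ C with M ⊆ N and C ⊆ R, the exponent is
-- k + (∣N∣ − ∣M∣) + (ρ(M ∪ C) − ∣C∣), and after division by t^k the sum is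
-- 1 modulo t if k < n or k = 0, and 2 modulo t if k = n is even and positive.
-- If k = n is odd, then n ≠ 1, the terms with M ≠ N vanish modulo t² because
-- those for C and R ∖ C cancel modulo t, and the terms with M = N give
-- 1 + tⁿ − (1 + t)ⁿ ≡ −n t modulo t².  Take t larger than n and 2.

-- Nothing is evaluated at the rational point 1 + 1/t. The powers of y - 1 form a basis of ℤ[y], so
-- a linear functional can take any prescribed integer values on them, and the values t ^ (∣Q∣ - m)
-- on (y - 1) ^ m have their denominators already cleared. Functionals also make the trailing zeros
-- of coefficient lists invisible. Irreducibility is what makes the terms with M = N computable: N
-- together with any single root edge already reaches all that Q reaches, so ρ(N ∪ C) is the same
-- for every nonempty C, whereas ρ(N) = 0. The obstacle is k = n odd: modulo t the contributions 1
-- of C = ∅ and -1 of C = R cancel, which forces the passage to t². What helps there is that k = n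
-- makes every reached vertex a neighbour of the root. Then ρ(M ∪ C) = ∣C∣ says that no edge of M
-- joins the vertices reached by C to the others, a condition symmetric in C and R ∖ C. The case k =
-- n = 1 is a root leaf; this is where the absence of root leaves enters.

open import Defs
open import Algebra.Bundles.Raw using (RawRing)
import Algebra.Definitions.RawSemiring as RawSemiringDefinitions
import Algebra.Properties.CommutativeSemigroup as CommutativeSemigroup
open import Data.Bool.Base using (true; false)
open import Data.Empty as Empty using (⊥-elim)
open import Data.Fin.Base as Fin using (Fin; zero; suc)
import Data.Fin.Properties as Fin
open import Data.Fin.Subset hiding (_-_)
open import Data.Fin.Subset.Properties
open import Data.Integer.Base as ℤ
  using (ℤ; -_; _+_; _-_; _*_; _^_; 0ℤ; 1ℤ; -1ℤ; +-*-rawRing)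
open import Data.Integer.Divisibility.Signed hiding (quotient)
import Data.Integer.Properties as ℤ
open import Data.Integer.Tactic.RingSolver using (solve-∀)
open import Data.List.Base
  using (List; []; _∷_; _++_; length; map; foldr; filter; drop; tabulate; allFin)
open import Data.List.Extrema.Nat using (max≤v⁺; v≤max⁺)
import Data.List.Membership.Propositional as List
open import Data.List.Membership.Propositional.Properties
  using (∈-map⁺; ∈-filter⁺; ∈-filter⁻; ∈-++⁺ˡ; ∈-++⁺ʳ; ∈-allFin)
open import Data.List.Relation.Unary.All as All using (All; []; _∷_)
import Data.List.Relation.Unary.All.Properties as All
open import Data.List.Relation.Unary.AllPairs.Core using ([]; _∷_)
open import Data.List.Relation.Unary.Any as Any using (here; there)
open import Data.List.Relation.Unary.Linked as Linked using (Linked; [-]; _∷_)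
open import Data.List.Relation.Unary.Unique.Propositional using (Unique)
import Data.List.Relation.Unary.Unique.Propositional.Properties as Unique
open import Data.Nat.Base as ℕ using (ℕ; zero; suc; _∸_; _≤_; _<_; z≤n; s≤s)
import Data.Nat.Divisibility as ℕ
open import Data.Nat.Induction using (<-wellFounded)
import Data.Nat.Properties as ℕ
open import Data.Product.Base using (∃; ∃₂; _×_; _,_; proj₁; proj₂)
open import Data.Sum.Base as Sum using (_⊎_; inj₁; inj₂)
import Data.Vec.Base as Vec
import Data.Vec.Properties as Vec
open import Function.Base using (_∘_; id; case_of_)
open import Function.Bundles using (_⇔_; mk⇔; Equivalence)
open import Induction.WellFounded using (Acc; acc)
open import Level using (Level; 0ℓ)
open import Relation.Binary.Construct.Closure.ReflexiveTransitive as Star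
  using (Star; ε; _◅_; _◅◅_)
open import Relation.Binary.Core using (Rel)
open import Relation.Binary.PropositionalEquality
open import Relation.Nullary using (¬_; Dec; yes; no; does; ¬?; _×-dec_; _⊎-dec_)
open import Relation.Nullary.Decidable using (decidable-stable; map′)
open import Relation.Unary using (Pred; Decidable)
open CommutativeSemigroup ℕ.+-commutativeSemigroup
  using () renaming (interchange to ℕ-interchange)

-- Sums over the subsets of a finite set

Disjoint : ∀ {n} → Subset n → Subset n → Set
Disjoint p q = ∀ {i} → i ∈ p → i ∉ q

Disjoint-tail : ∀ {n s t} {p q : Subset n} → Disjoint (s Vec.∷ p) (t Vec.∷ q) → Disjoint p q
Disjoint-tail d i∈p i∈q = d (Vec.there i∈p) (Vec.there i∈q)

∣p∪q∣≡∣p∣+∣q∣ : ∀ {n} (p q : Subset n) → Disjoint p q → ∣ p ∪ q ∣ ≡ ∣ p ∣ ℕ.+ ∣ q ∣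
∣p∪q∣≡∣p∣+∣q∣ Vec.[] Vec.[] d = refl
∣p∪q∣≡∣p∣+∣q∣ (outside Vec.∷ p) (outside Vec.∷ q) d = ∣p∪q∣≡∣p∣+∣q∣ p q (Disjoint-tail d)
∣p∪q∣≡∣p∣+∣q∣ (outside Vec.∷ p) (inside Vec.∷ q) d =
  trans (cong suc (∣p∪q∣≡∣p∣+∣q∣ p q (Disjoint-tail d))) (sym (ℕ.+-suc _ _))
∣p∪q∣≡∣p∣+∣q∣ (inside Vec.∷ p) (outside Vec.∷ q) d = cong suc (∣p∪q∣≡∣p∣+∣q∣ p q (Disjoint-tail d))
∣p∪q∣≡∣p∣+∣q∣ (inside Vec.∷ p) (inside Vec.∷ q) d = ⊥-elim (d Vec.here Vec.here)

x∈p─q⇒x∉q : ∀ {n} (p q : Subset n) → Disjoint (p ─ q) q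
x∈p─q⇒x∉q (_ Vec.∷ p) (outside Vec.∷ q) (Vec.there i∈) (Vec.there i∈q) = x∈p─q⇒x∉q p q i∈ i∈q
x∈p─q⇒x∉q (_ Vec.∷ p) (inside Vec.∷ q) (Vec.there i∈) (Vec.there i∈q) = x∈p─q⇒x∉q p q i∈ i∈q

p⊆q∪p─q : ∀ {n} (p q : Subset n) → p ⊆ q ∪ (p ─ q)
p⊆q∪p─q p q {i} i∈p with i ∈? q
... | yes i∈q = x∈p∪q⁺ (inj₁ i∈q)
... | no  i∉q = x∈p∪q⁺ (inj₂ (x∈p∧x∉q⇒x∈p─q i∈p i∉q))

∪-lub : ∀ {n} {p q r : Subset n} → p ⊆ r → q ⊆ r → p ∪ q ⊆ r
∪-lub p⊆r q⊆r i∈ with x∈p∪q⁻ _ _ i∈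
... | inj₁ i∈p = p⊆r i∈p
... | inj₂ i∈q = q⊆r i∈q

q∪p─q≡p : ∀ {n} {p q : Subset n} → q ⊆ p → q ∪ (p ─ q) ≡ p
q∪p─q≡p {p = p} {q} q⊆p = ⊆-antisym (∪-lub q⊆p (p─q⊆p p q)) (p⊆q∪p─q p q)

∣q∣+∣p─q∣≡∣p∣ : ∀ {n} {p q : Subset n} → q ⊆ p → ∣ q ∣ ℕ.+ ∣ p ─ q ∣ ≡ ∣ p ∣
∣q∣+∣p─q∣≡∣p∣ {p = p} {q} q⊆p =
  trans (sym (∣p∪q∣≡∣p∣+∣q∣ q (p ─ q) λ i∈q i∈ → x∈p─q⇒x∉q p q i∈ i∈q)) (cong ∣_∣ (q∪p─q≡p q⊆p))

p⊆q∧∣q∣≤∣p∣⇒p≡q : ∀ {n} {p q : Subset n} → p ⊆ q → ∣ q ∣ ≤ ∣ p ∣ → p ≡ q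
p⊆q∧∣q∣≤∣p∣⇒p≡q {p = p} {q} p⊆q q≤p = ⊆-antisym p⊆q λ {i} i∈q → helper i i∈q
  where
  helper : ∀ i → i ∈ q → i ∈ p
  helper i i∈q with i ∈? p
  ... | yes i∈p = i∈p
  ... | no  i∉p = ⊥-elim (ℕ.<⇒≱ (p⊂q⇒∣p∣<∣q∣ (p⊆q , i , i∈q , i∉p)) q≤p)

⟦_⟧ : ∀ {n ℓ} {P : Pred (Fin n) ℓ} → Decidable P → Subset n
⟦ P? ⟧ = Vec.tabulate (does ∘ P?)

module _ {n : ℕ} {ℓ : Level} {P : Pred (Fin n) ℓ} (P? : Decidable P) where

  ∈⟦⟧⁺ : ∀ {i} → P i → i ∈ ⟦ P? ⟧
  ∈⟦⟧⁺ {i} pi = Vec.lookup⇒[]= i _ (trans (Vec.lookup∘tabulate _ i) (helper (P? i)))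
    where
    helper : (d : Dec (P i)) → does d ≡ true
    helper (yes _) = refl
    helper (no ¬p) = ⊥-elim (¬p pi)

  ∈⟦⟧⁻ : ∀ {i} → i ∈ ⟦ P? ⟧ → P i
  ∈⟦⟧⁻ {i} i∈ = helper (P? i) (trans (sym (Vec.lookup∘tabulate _ i)) (Vec.[]=⇒lookup i∈))
    where
    helper : (d : Dec (P i)) → does d ≡ true → P i
    helper (yes pi) _ = pi


-- Induction on `p`, deleting from `q` the partner of the first element; injectivity keeps the
-- partners of the other elements in what remains. A relation replaces a map because the far end of
-- a root edge is known only by existence.
∣∣-injection : ∀ {m n} (p : Subset m) (q : Subset n) (_~_ : Fin m → Fin n → Set) →
               (∀ {i} → i ∈ p → ∃ λ j → j ∈ q × i ~ j) →
               (∀ {i i′ j} → i ~ j → i′ ~ j → i ≡ i′) → ∣ p ∣ ≤ ∣ q ∣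
∣∣-injection Vec.[]            q _~_ total inj = z≤n
∣∣-injection (outside Vec.∷ p) q _~_ total inj =
  ∣∣-injection p q (λ i → suc i ~_) (total ∘ Vec.there) λ r r′ → Fin.suc-injective (inj r r′)
∣∣-injection (inside Vec.∷ p)  q _~_ total inj with total Vec.here
... | j₀ , j₀∈q , r₀ = ℕ.≤-<-trans
  (∣∣-injection p (q ─ ⁅ j₀ ⁆) (λ i → suc i ~_)
    (λ i∈p → let j , j∈q , r = total (Vec.there i∈p) in
      j , x∈p∧x≢y⇒x∈p-y j∈q (λ { refl → Fin.0≢1+n (inj r₀ r) }) , r)
    λ r r′ → Fin.suc-injective (inj r r′))
  (x∈p⇒∣p-x∣<∣p∣ j₀∈q)

-- `q` shrinks inside a fixed `Subset n`, so deleting edges never changes the edge type and no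
-- smaller graph has to be built.
∑⊆ : ∀ {n} → Subset n → (Subset n → ℤ) → ℤ
∑⊆ Vec.[]            f = f Vec.[]
∑⊆ (outside Vec.∷ q) f = ∑⊆ q (f ∘ (outside Vec.∷_))
∑⊆ (inside Vec.∷ q)  f = ∑⊆ q (f ∘ (outside Vec.∷_)) + ∑⊆ q (f ∘ (inside Vec.∷_))

∑-cong : ∀ {n} (q : Subset n) {f g : Subset n → ℤ} →
         (∀ a → a ⊆ q → f a ≡ g a) → ∑⊆ q f ≡ ∑⊆ q g
∑-cong Vec.[]            eq = eq Vec.[] ⊆-refl
∑-cong (outside Vec.∷ q) eq = ∑-cong q λ a a⊆q → eq _ (out⊆ a⊆q)
∑-cong (inside Vec.∷ q)  eq =
  cong₂ _+_ (∑-cong q λ a a⊆q → eq _ (out⊆ a⊆q)) (∑-cong q λ a a⊆q → eq _ (in⊆in a⊆q))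

∑-+ : ∀ {n} (q : Subset n) (f g : Subset n → ℤ) →
      ∑⊆ q (λ a → f a + g a) ≡ ∑⊆ q f + ∑⊆ q g
∑-+ Vec.[]            f g = refl
∑-+ (outside Vec.∷ q) f g = ∑-+ q _ _
∑-+ (inside Vec.∷ q)  f g =
  trans (cong₂ _+_ (∑-+ q (f ∘ (outside Vec.∷_)) (g ∘ (outside Vec.∷_)))
                   (∑-+ q (f ∘ (inside Vec.∷_)) (g ∘ (inside Vec.∷_))))
        (interchange (∑⊆ q (f ∘ (outside Vec.∷_))) _ (∑⊆ q (f ∘ (inside Vec.∷_))) _)
  where
  interchange : ∀ a b c d → (a + b) + (c + d) ≡ (a + c) + (b + d)
  interchange = solve-∀

∑-* : ∀ {n} (q : Subset n) c (f : Subset n → ℤ) → ∑⊆ q (λ a → c * f a) ≡ c * ∑⊆ q f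
∑-* Vec.[]            c f = refl
∑-* (outside Vec.∷ q) c f = ∑-* q c _
∑-* (inside Vec.∷ q)  c f =
  trans (cong₂ _+_ (∑-* q c _) (∑-* q c _)) (sym (ℤ.*-distribˡ-+ c _ _))

∑-∪ : ∀ {n} (p q : Subset n) → Disjoint p q → (f : Subset n → ℤ) →
      ∑⊆ (p ∪ q) f ≡ ∑⊆ p (λ a → ∑⊆ q (λ b → f (a ∪ b)))
∑-∪ Vec.[]            Vec.[]            d f = refl
∑-∪ (outside Vec.∷ p) (outside Vec.∷ q) d f = ∑-∪ p q (Disjoint-tail d) _
∑-∪ (outside Vec.∷ p) (inside Vec.∷ q)  d f =
  trans (cong₂ _+_ (∑-∪ p q (Disjoint-tail d) _) (∑-∪ p q (Disjoint-tail d) _))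
        (sym (∑-+ p _ _))
∑-∪ (inside Vec.∷ p)  (outside Vec.∷ q) d f =
  cong₂ _+_ (∑-∪ p q (Disjoint-tail d) _) (∑-∪ p q (Disjoint-tail d) _)
∑-∪ (inside Vec.∷ p)  (inside Vec.∷ q)  d f = ⊥-elim (d Vec.here Vec.here)

∑-⊥ : ∀ n (f : Subset n → ℤ) → ∑⊆ ⊥ f ≡ f ⊥
∑-⊥ zero    f = refl
∑-⊥ (suc n) f = ∑-⊥ n _

∑-⁅⁆ : ∀ {n} (e : Fin n) (f : Subset n → ℤ) → ∑⊆ ⁅ e ⁆ f ≡ f ⊥ + f ⁅ e ⁆
∑-⁅⁆ {suc n} zero f = cong₂ _+_ (∑-⊥ n _) (∑-⊥ n _)
∑-⁅⁆ (suc e) f = ∑-⁅⁆ e _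

module _ {d : ℤ} where

  ∑-∣ : ∀ {n} (q : Subset n) (f : Subset n → ℤ) → (∀ a → a ⊆ q → d ∣ f a) → d ∣ ∑⊆ q f
  ∑-∣ Vec.[]            f d∣ = d∣ Vec.[] ⊆-refl
  ∑-∣ (outside Vec.∷ q) f d∣ = ∑-∣ q _ λ a a⊆q → d∣ _ (out⊆ a⊆q)
  ∑-∣ (inside Vec.∷ q)  f d∣ = ∣m∣n⇒∣m+n
    (∑-∣ q _ λ a a⊆q → d∣ _ (out⊆ a⊆q)) (∑-∣ q _ λ a a⊆q → d∣ _ (in⊆in a⊆q))

  ∑-largest : ∀ {n} (q : Subset n) (f : Subset n → ℤ) →
              (∀ a → a ⊆ q → a ≢ q → d ∣ f a) → d ∣ ∑⊆ q f - f q
  ∑-largest Vec.[]            f d∣ = subst (d ∣_) (sym (ℤ.+-inverseʳ (f Vec.[]))) (divides 0ℤ refl)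
  ∑-largest (outside Vec.∷ q) f d∣ =
    ∑-largest q _ λ a a⊆q a≢q → d∣ _ (out⊆ a⊆q) (a≢q ∘ Vec.∷-injectiveʳ)
  ∑-largest (inside Vec.∷ q)  f d∣ = subst (d ∣_) (sym (ℤ.+-assoc (∑⊆ q (f ∘ (outside Vec.∷_))) _ _))
    (∣m∣n⇒∣m+n (∑-∣ q _ λ a a⊆q → d∣ _ (out⊆ a⊆q) λ ())
               (∑-largest q _ λ a a⊆q a≢q → d∣ _ (in⊆in a⊆q) (a≢q ∘ Vec.∷-injectiveʳ)))

  ∑-smallest : ∀ {n} (q : Subset n) (f : Subset n → ℤ) →
               (∀ a → a ⊆ q → Nonempty a → d ∣ f a) → d ∣ ∑⊆ q f - f ⊥
  ∑-smallest Vec.[]            f d∣ = subst (d ∣_) (sym (ℤ.+-inverseʳ (f Vec.[]))) (divides 0ℤ refl)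
  ∑-smallest (outside Vec.∷ q) f d∣ =
    ∑-smallest q _ λ a a⊆q (i , i∈a) → d∣ _ (out⊆ a⊆q) (suc i , Vec.there i∈a)
  ∑-smallest (inside Vec.∷ q)  f d∣ =
    subst (d ∣_) (swap (∑⊆ q (f ∘ (outside Vec.∷_))) _ (f ⊥))
      (∣m∣n⇒∣m+n (∑-smallest q _ λ a a⊆q (i , i∈a) → d∣ _ (out⊆ a⊆q) (suc i , Vec.there i∈a))
                 (∑-∣ q _ λ a a⊆q → d∣ _ (in⊆in a⊆q) (zero , Vec.here)))
    where
    swap : ∀ a b c → (a - c) + b ≡ (a + b) - c
    swap = solve-∀

-- This is `∑-smallest` for the difference of `f` and `g` with divisor 0, since 0 divides only 0.
∑-agree-nonempty : ∀ {n} (q : Subset n) (f g : Subset n → ℤ) →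
                   (∀ a → a ⊆ q → Nonempty a → f a ≡ g a) → ∑⊆ q f - f ⊥ ≡ ∑⊆ q g - g ⊥
∑-agree-nonempty q f g eq = ℤ.i-j≡0⇒i≡j _ _ (trans (sym rearranged)
  (0∣⇒≡0 (∑-smallest q (λ a → f a + -1ℤ * g a)
    λ a a⊆q ne → divides 0ℤ (trans (cong (_+ -1ℤ * g a) (eq a a⊆q ne)) (cancel (g a))))))
  where
  cancel : ∀ a → a + -1ℤ * a ≡ 0ℤ
  cancel = solve-∀
  regroup : ∀ a b c d → (a + -1ℤ * b) - (c + -1ℤ * d) ≡ (a - c) - (b - d)
  regroup = solve-∀
  rearranged : ∑⊆ q (λ a → f a + -1ℤ * g a) - (f ⊥ + -1ℤ * g ⊥) ≡
               (∑⊆ q f - f ⊥) - (∑⊆ q g - g ⊥)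
  rearranged = trans
    (cong (_- _) (trans (∑-+ q f _) (cong (∑⊆ q f +_) (∑-* q -1ℤ g))))
    (regroup (∑⊆ q f) (∑⊆ q g) (f ⊥) (g ⊥))

∑-complement : ∀ {n} (q : Subset n) (f : Subset n → ℤ) → ∑⊆ q f ≡ ∑⊆ q (λ a → f (q ─ a))
∑-complement Vec.[]            f = refl
∑-complement (outside Vec.∷ q) f = ∑-complement q _
∑-complement (inside Vec.∷ q)  f = trans (ℤ.+-comm (∑⊆ q (f ∘ (outside Vec.∷_))) _)
  (cong₂ _+_ (∑-complement q _) (∑-complement q _))

-- No division by 2 is needed: fixing one element of q selects one
-- representative of each complementary pair.
∑-complementary-pairs : ∀ {n} {d} (q : Subset n) (f : Subset n → ℤ) → Nonempty q →
  (∀ a → a ⊆ q → d ∣ f a + f (q ─ a)) → d ∣ ∑⊆ q f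
∑-complementary-pairs (outside Vec.∷ q) f (suc i , Vec.there i∈q) d∣ =
  ∑-complementary-pairs q _ (i , i∈q) λ a a⊆q → d∣ _ (out⊆ a⊆q)
∑-complementary-pairs (inside Vec.∷ q) f _ d∣ = subst (_ ∣_)
  (trans (∑-+ q _ _) (cong (∑⊆ q (f ∘ (outside Vec.∷_)) +_) (sym (∑-complement q _))))
  (∑-∣ q (λ a → f (outside Vec.∷ a) + f (inside Vec.∷ (q ─ a))) λ a a⊆q → d∣ _ (out⊆ a⊆q))

∑-binomial : ∀ {n} (q : Subset n) t → ∑⊆ q (λ a → t ^ (∣ q ∣ ∸ ∣ a ∣)) ≡ (1ℤ + t) ^ ∣ q ∣
∑-binomial Vec.[]            t = refl
∑-binomial (outside Vec.∷ q) t = ∑-binomial q t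
∑-binomial (inside Vec.∷ q)  t = begin
  ∑⊆ q (λ a → t ^ (suc ∣ q ∣ ∸ ∣ a ∣)) + ∑⊆ q (λ a → t ^ (∣ q ∣ ∸ ∣ a ∣))
    ≡⟨ cong (_+ ∑⊆ q (λ a → t ^ (∣ q ∣ ∸ ∣ a ∣))) (trans
         (∑-cong q λ a a⊆q → cong (t ^_) (ℕ.+-∸-assoc 1 (p⊆q⇒∣p∣≤∣q∣ a⊆q)))
         (∑-* q t _)) ⟩
  t * ∑⊆ q (λ a → t ^ (∣ q ∣ ∸ ∣ a ∣)) + ∑⊆ q (λ a → t ^ (∣ q ∣ ∸ ∣ a ∣))
    ≡⟨ collect t _ ⟩
  (1ℤ + t) * ∑⊆ q (λ a → t ^ (∣ q ∣ ∸ ∣ a ∣)) ≡⟨ cong ((1ℤ + t) *_) (∑-binomial q t) ⟩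
  (1ℤ + t) ^ suc ∣ q ∣ ∎
  where
  open ≡-Reasoning
  collect : ∀ a b → a * b + b ≡ (1ℤ + a) * b
  collect = solve-∀

-- Rank

module _ {V : Set} where

  data Path (R : Rel V 0ℓ) : V → V → List V → Set where
    [_] : ∀ v → Path R v v (v ∷ [])
    _∷_ : ∀ {u w v ws} → R u w → Path R w v ws → Path R u v (u ∷ ws)

  path-suffix : ∀ {R u w v ws} → Path R w v ws → u List.∈ ws →
                ∃ λ us → Path R u v us × (Unique ws → Unique us)
  path-suffix [ v ]       (here refl) = _ , [ v ] , id
  path-suffix p@(_ ∷ _)   (here refl) = _ , p , id
  path-suffix (_ ∷ p)     (there u∈)  =
    let us , q , unique = path-suffix p u∈ in us , q , λ { (_ ∷ u) → unique u }

  simplePath : (∀ (u v : V) → Dec (u ≡ v)) → ∀ {R u v} → Star R u v →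
               ∃ λ ws → Path R u v ws × Unique ws
  simplePath _≟_ {u = u} ε = u ∷ [] , [ u ] , [] ∷ []
  simplePath _≟_ {u = u} (r ◅ rs) with simplePath _≟_ rs
  ... | ws , p , unique with Any.any? (u ≟_) ws
  ...   | yes u∈ = let us , q , unique′ = path-suffix p u∈ in us , q , unique′ unique
  ...   | no  u∉ = u ∷ ws , r ∷ p , All.¬Any⇒All¬ ws u∉ ∷ unique

  path⇒linked : ∀ {R u v w ws} → Path R u v ws → R v w → Linked R (ws ++ w ∷ [])
  path⇒linked [ _ ]           r′ = r′ ∷ [-]
  path⇒linked (r ∷ [ _ ])     r′ = r ∷ r′ ∷ [-]
  path⇒linked (r ∷ p@(_ ∷ _)) r′ = r ∷ path⇒linked p r′

∈-subsets : ∀ {n} (a : Subset n) → a List.∈ subsets n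
∈-subsets Vec.[]              = here refl
∈-subsets (outside Vec.∷ a)   = ∈-++⁺ˡ (∈-map⁺ _ (∈-subsets a))
∈-subsets {suc n} (inside Vec.∷ a) =
  ∈-++⁺ʳ (map (outside Vec.∷_) (subsets n)) (∈-map⁺ _ (∈-subsets a))

module Reach (G : SimpleRootedGraph) where
  open SimpleRootedGraph G

  Walk : Subset #E → Rel (Fin #V) 0ℓ
  Walk A = Reachable G (spanning G A)

  infix 4 _∈ᵣ_
  -- The root is adjoined here because `reached` leaves it out, which makes `ρ` a plain cardinality.
  _∈ᵣ_ : Fin #V → Subset #V → Set
  v ∈ᵣ W = v ≡ root ⊎ v ∈ W

  _∈ᵣ?_ : ∀ v W → Dec (v ∈ᵣ W)
  v ∈ᵣ? W = (v Fin.≟ root) ⊎-dec (v ∈? W)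

  Joins-sym : ∀ {e u v} → Joins e u v → Joins e v u
  Joins-sym = Sum.swap

  Joins-ends : ∀ {e u v u′ v′} → Joins e u v → Joins e u′ v′ →
               (u ≡ u′ × v ≡ v′) ⊎ (u ≡ v′ × v ≡ u′)
  Joins-ends (inj₁ p) (inj₁ q) with refl ← trans (sym p) q = inj₁ (refl , refl)
  Joins-ends (inj₁ p) (inj₂ q) with refl ← trans (sym p) q = inj₂ (refl , refl)
  Joins-ends (inj₂ p) (inj₁ q) with refl ← trans (sym p) q = inj₂ (refl , refl)
  Joins-ends (inj₂ p) (inj₂ q) with refl ← trans (sym p) q = inj₁ (refl , refl)

  Joins⇒Incident : ∀ {e u v} → Joins e u v → Incident G e v
  Joins⇒Incident (inj₁ p) = inj₂ (cong proj₂ p)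
  Joins⇒Incident (inj₂ p) = inj₁ (cong proj₁ p)

  Incident⇒Joins : ∀ {e v} → Incident G e v → ∃ λ u → Joins e u v
  Incident⇒Joins {e} (inj₁ refl) = proj₂ (ends e) , inj₂ refl
  Incident⇒Joins {e} (inj₂ refl) = proj₁ (ends e) , inj₁ refl

  Walk-sym : ∀ {A u v} → Walk A u v → Walk A v u
  Walk-sym = Star.reverse λ (e , e∈A , j) → e , e∈A , Joins-sym j

  Walk-mono : ∀ {A B u v} → A ⊆ B → Walk A u v → Walk B u v
  Walk-mono A⊆B = Star.map λ (e , e∈A , j) → e , A⊆B e∈A , j

  reached? : ∀ A v → Dec (v ≢ root × Walk A root v)
  reached? A v = ¬? (v Fin.≟ root) ×-dec reachable? G (spanning G A) (_∈? A) root v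

  abstract

    reached : Subset #E → Subset #V
    reached A = ⟦ reached? A ⟧

    ∈reached⁺ : ∀ {A v} → v ≢ root → Walk A root v → v ∈ reached A
    ∈reached⁺ {A} v≢r w = ∈⟦⟧⁺ (reached? A) (v≢r , w)

    ∈reached⁻ : ∀ {A v} → v ∈ reached A → v ≢ root × Walk A root v
    ∈reached⁻ {A} = ∈⟦⟧⁻ (reached? A)

  module _ {A : Subset #E} {v : Fin #V} where

    reached-≢root : v ∈ reached A → v ≢ root
    reached-≢root = proj₁ ∘ ∈reached⁻

    reached⇒walk : v ∈ reached A → Walk A root v
    reached⇒walk = proj₂ ∘ ∈reached⁻

    ∈ᵣreached⁺ : Walk A root v → v ∈ᵣ reached A
    ∈ᵣreached⁺ w with v Fin.≟ root
    ... | yes v≡r = inj₁ v≡r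
    ... | no  v≢r = inj₂ (∈reached⁺ v≢r w)

    ∈ᵣreached⁻ : v ∈ᵣ reached A → Walk A root v
    ∈ᵣreached⁻ (inj₁ refl) = ε
    ∈ᵣreached⁻ (inj₂ v∈)   = reached⇒walk v∈

  Closed : Subset #E → Subset #V → Set
  Closed A W = ∀ {e u v} → e ∈ A → Joins e u v → u ∈ᵣ W → v ∈ᵣ W

  closed-walk : ∀ {A W u v} → Closed A W → Walk A u v → u ∈ᵣ W → v ∈ᵣ W
  closed-walk closed ε                   u∈ = u∈
  closed-walk closed ((e , e∈A , j) ◅ w) u∈ = closed-walk closed w (closed e∈A j u∈)

  reached-closed : ∀ {A} → Closed A (reached A)
  reached-closed e∈A j u∈ = ∈ᵣreached⁺ (∈ᵣreached⁻ u∈ ◅◅ (_ , e∈A , j) ◅ ε)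

  -- The tool for bounding reached sets from above: it is enough to exhibit a closed set.
  reached-least : ∀ {A W} → Closed A W → reached A ⊆ W
  reached-least closed v∈ with closed-walk closed (reached⇒walk v∈) (inj₁ refl)
  ... | inj₁ v≡r = ⊥-elim (reached-≢root v∈ v≡r)
  ... | inj₂ v∈W = v∈W

  reached-mono : ∀ {A B} → A ⊆ B → reached A ⊆ reached B
  reached-mono A⊆B = reached-least λ e∈A → reached-closed (A⊆B e∈A)

  lastEdge : ∀ {A u v} → Walk A u v → u ≡ v ⊎ ∃₂ λ e w → e ∈ A × Joins e w v
  lastEdge ε = inj₁ refl
  lastEdge ((e , e∈A , j) ◅ w) with lastEdge w
  ... | inj₁ refl = inj₂ (e , _ , e∈A , j)
  ... | inj₂ last = inj₂ last

  reached⇒touched : ∀ {A v} → v ∈ reached A → ∃₂ λ e u → e ∈ A × Joins e u v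
  reached⇒touched v∈ with lastEdge (reached⇒walk v∈)
  ... | inj₁ r≡v  = ⊥-elim (reached-≢root v∈ (sym r≡v))
  ... | inj₂ last = last

  Separated : Subset #E → Subset #E → Set
  Separated A B = ∀ {e f u w v} → e ∈ A → f ∈ B → Joins e u v → Joins f w v → v ≡ root

  ρ : Subset #E → ℕ
  ρ A = ∣ reached A ∣

  ρ-mono : ∀ {A B} → A ⊆ B → ρ A ≤ ρ B
  ρ-mono A⊆B = p⊆q⇒∣p∣≤∣q∣ (reached-mono A⊆B)

  module _ {A B : Subset #E} (sep : Separated A B) where

    -- The right-hand side is closed: an edge of `A` starting at a non-root vertex reached by `B`
    -- would share that vertex with an edge of `B`, against separation.
    reached-∪ : reached (A ∪ B) ≡ reached A ∪ reached B
    reached-∪ = ⊆-antisym (reached-least closed)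
      (∪-lub (reached-mono (p⊆p∪q B)) (reached-mono (q⊆p∪q A B)))
      where
      fromA : ∀ {v} → v ∈ᵣ reached A → v ∈ᵣ reached A ∪ reached B
      fromA = Sum.map₂ (p⊆p∪q _)
      fromB : ∀ {v} → v ∈ᵣ reached B → v ∈ᵣ reached A ∪ reached B
      fromB = Sum.map₂ (q⊆p∪q _ _)
      closed : Closed (A ∪ B) (reached A ∪ reached B)
      closed e∈ j u∈ with x∈p∪q⁻ A B e∈ | u∈
      ... | inj₁ e∈A | inj₁ u≡r = fromA (reached-closed e∈A j (inj₁ u≡r))
      ... | inj₂ e∈B | inj₁ u≡r = fromB (reached-closed e∈B j (inj₁ u≡r))
      ... | inj₁ e∈A | inj₂ u∈′ with x∈p∪q⁻ (reached A) _ u∈′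
      ...   | inj₁ u∈A = fromA (reached-closed e∈A j (inj₂ u∈A))
      ...   | inj₂ u∈B = let f , _ , f∈B , j′ = reached⇒touched u∈B in
                         ⊥-elim (reached-≢root u∈B (sep e∈A f∈B (Joins-sym j) j′))
      closed e∈ j u∈ | inj₂ e∈B | inj₂ u∈′ with x∈p∪q⁻ (reached A) _ u∈′
      ...   | inj₂ u∈B = fromB (reached-closed e∈B j (inj₂ u∈B))
      ...   | inj₁ u∈A = let f , _ , f∈A , j′ = reached⇒touched u∈A in
                         ⊥-elim (reached-≢root u∈A (sep f∈A e∈B j′ (Joins-sym j)))

    ρ-∪ : ρ (A ∪ B) ≡ ρ A ℕ.+ ρ B
    ρ-∪ = trans (cong ∣_∣ reached-∪) (∣p∪q∣≡∣p∣+∣q∣ (reached A) (reached B) disjoint)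
      where
      disjoint : Disjoint (reached A) (reached B)
      disjoint v∈A v∈B =
        let e , _ , e∈A , j  = reached⇒touched v∈A
            f , _ , f∈B , j′ = reached⇒touched v∈B
        in reached-≢root v∈A (sep e∈A f∈B j j′)

  -- A partial search tree with edges `B` and non-root vertices `S`. Being a tree is recorded by
  -- counting alone; acyclicity is recovered from the count later.
  record Tree (A B : Subset #E) (S : Subset #V) : Set where
    field
      edges⊆  : B ⊆ A
      spans   : S ⊆ reached B
      size    : ∣ S ∣ ≡ ∣ B ∣
      endsWithin : ∀ {e u v} → e ∈ B → Joins e u v → v ∈ᵣ S

  -- Greedy search: as long as some edge of `A` leaves `S`, that edge and its new end are added. `k`
  -- is fuel; once it is 0, `S` would have all vertices and yet miss one.
  grow : ∀ k {A B S} → Tree A B S → #V ≤ k ℕ.+ ∣ S ∣ → ∃₂ λ B S → Tree A B S × Closed A S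
  grow k {A} {B} {S} t bound
    with Fin.any? (λ e → Fin.any? λ u → Fin.any? λ v →
           (e ∈? A) ×-dec (joins? G e u v ×-dec ((u ∈ᵣ? S) ×-dec ¬? (v ∈ᵣ? S))))
  ... | no none = B , S , t , λ {e} {u} {v} e∈A j u∈ →
    decidable-stable (v ∈ᵣ? S) λ v∉ → none (e , u , v , e∈A , j , u∈ , v∉)
  ... | yes (e , u , v , e∈A , j , u∈ , v∉) = extend k bound
    where
    open Tree t
    disjoint : ∀ {n} {p : Subset n} {i} → i ∉ p → Disjoint p ⁅ i ⁆
    disjoint i∉p j∈p j∈i with refl ← x∈⁅y⁆⇒x≡y _ j∈i = i∉p j∈p
    ∣∪⁅⁆∣ : ∀ {n} {p : Subset n} {i} → i ∉ p → ∣ p ∪ ⁅ i ⁆ ∣ ≡ ∣ p ∣ ℕ.+ 1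
    ∣∪⁅⁆∣ {p = p} {i} i∉p =
      trans (∣p∪q∣≡∣p∣+∣q∣ p _ (disjoint i∉p)) (cong (∣ p ∣ ℕ.+_) (∣⁅x⁆∣≡1 i))
    v∉S : v ∉ S
    v∉S = v∉ ∘ inj₂
    u∈B : u ∈ᵣ reached B
    u∈B = Sum.map₂ spans u∈
    t′ : Tree A (B ∪ ⁅ e ⁆) (S ∪ ⁅ v ⁆)
    t′ = record
      { edges⊆ = ∪-lub edges⊆ λ i∈ → subst (_∈ A) (sym (x∈⁅y⁆⇒x≡y e i∈)) e∈A
      ; spans  = ∪-lub (reached-mono (p⊆p∪q _) ∘ spans) λ i∈ →
          subst (_∈ reached _) (sym (x∈⁅y⁆⇒x≡y v i∈))
            (∈reached⁺ (v∉ ∘ inj₁) (Walk-mono (p⊆p∪q _) (∈ᵣreached⁻ u∈B) ◅◅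
              (e , q⊆p∪q B _ (x∈⁅x⁆ e) , j) ◅ ε))
      ; size   = trans (∣∪⁅⁆∣ v∉S) (trans (cong (ℕ._+ 1) size)
          (sym (∣∪⁅⁆∣ λ e∈B → v∉ (endsWithin e∈B j))))
      ; endsWithin = λ f∈ j′ → helper (x∈p∪q⁻ B _ f∈) j′
      }
      where
      helper : ∀ {f a b} → f ∈ B ⊎ f ∈ ⁅ e ⁆ → Joins f a b → b ∈ᵣ S ∪ ⁅ v ⁆
      helper (inj₁ f∈B) j′ = Sum.map₂ (p⊆p∪q _) (endsWithin f∈B j′)
      helper (inj₂ f∈e) j′ with refl ← x∈⁅y⁆⇒x≡y e f∈e with Joins-ends j j′
      ... | inj₁ (_ , refl) = inj₂ (q⊆p∪q S _ (x∈⁅x⁆ v))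
      ... | inj₂ (refl , _) = Sum.map₂ (p⊆p∪q _) u∈
    extend : ∀ k → #V ≤ k ℕ.+ ∣ S ∣ → ∃₂ λ B S → Tree A B S × Closed A S
    extend zero    bound = ⊥-elim (ℕ.<⇒≱
      (ℕ.<-≤-trans (ℕ.≤-reflexive (trans (ℕ.+-comm 1 ∣ S ∣) (sym (∣∪⁅⁆∣ v∉S))))
                   (∣p∣≤n (S ∪ ⁅ v ⁆))) bound)
    extend (suc k) bound = grow k t′ (ℕ.≤-trans bound (ℕ.≤-reflexive
      (trans (sym (ℕ.+-suc k ∣ S ∣)) (cong (k ℕ.+_) (trans (ℕ.+-comm 1 ∣ S ∣) (sym (∣∪⁅⁆∣ v∉S)))))))

  record SpanningTree (A B : Subset #E) : Set where
    field
      edges⊆   : B ⊆ A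
      spans    : reached A ⊆ reached B
      size     : ρ A ≡ ∣ B ∣
      endsWithin  : ∀ {e u v} → e ∈ B → Joins e u v → v ∈ᵣ reached B

  spanningTree : ∀ A → ∃ (SpanningTree A)
  spanningTree A with grow #V {A} {⊥} {⊥} record
    { edges⊆ = ⊥-elim ∘ ∉⊥ ; spans = ⊥-elim ∘ ∉⊥ ; endsWithin = ⊥-elim ∘ ∉⊥
    ; size = trans (∣⊥∣≡0 #V) (sym (∣⊥∣≡0 #E)) } (ℕ.m≤m+n #V _)
  ... | B , S , t , closed = B , record
    { edges⊆  = edges⊆
    ; spans   = spans ∘ reached-least closed
    ; size    = trans (cong ∣_∣ (⊆-antisym (reached-least closed) (reached-mono edges⊆ ∘ spans))) size
    ; endsWithin = λ e∈ j → Sum.map₂ spans (endsWithin e∈ j)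
    }
    where open Tree t

  ρ≤∣∣ : ∀ A → ρ A ≤ ∣ A ∣
  ρ≤∣∣ A = let _ , t = spanningTree A in
    ℕ.≤-trans (ℕ.≤-reflexive (SpanningTree.size t)) (p⊆q⇒∣p∣≤∣q∣ (SpanningTree.edges⊆ t))

  module _ {A B : Subset #E} (t : SpanningTree A B) where
    open SpanningTree t

    private
      walk⇒component : ∀ {u v} → Walk B root u → Walk B u v → Reachable G (rootComponent G B) u v
      walk⇒component r ε = ε
      walk⇒component {u} r (_◅_ {j = v} (e , e∈B , j) w) =
        (e , (e∈B , within) , j) ◅ walk⇒component r′ w
        where
        r′ : Walk B root v
        r′ = r ◅◅ (e , e∈B , j) ◅ ε
        within : ∀ x → Incident G e x → Walk B root x
        within x i with Joins-ends j (proj₂ (Incident⇒Joins i))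
        ... | inj₁ (_ , refl) = r′
        ... | inj₂ (refl , _) = r

      connected : Connected G (rootComponent G B)
      connected ru rv =
        Star.reverse (λ (e , e∈B , j) → e , e∈B , Joins-sym j) (walk⇒component ε ru)
        ◅◅ walk⇒component ε rv

      -- The edge of B joining v and a is f, so the rest of the cycle avoids f.
      detour : ∀ {f v a} u us → Joins f v a → u ≢ v → All (v ≢_) us →
               u ≢ a → All (a ≢_) us → Linked (Adjacent G (spanning G B)) (u ∷ us ++ v ∷ []) →
               Walk (B ─ ⁅ f ⁆) u v
      detour {f} {v} {a} u [] j u≢v [] u≢a [] ((e , e∈B , j′) ∷ _) =
        (e , x∈p∧x∉q⇒x∈p─q e∈B e∉ , j′) ◅ ε
        where
        e∉ : e ∉ ⁅ f ⁆
        e∉ e∈ with refl ← x∈⁅y⁆⇒x≡y f e∈ with Joins-ends j j′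
        ... | inj₁ (v≡u , _) = u≢v (sym v≡u)
        ... | inj₂ (_ , a≡u) = u≢a (sym a≡u)
      detour {f} {v} {a} u (w ∷ ws) j u≢v (v≢w ∷ v≢) u≢a (a≢w ∷ a≢) ((e , e∈B , j′) ∷ l) =
        (e , x∈p∧x∉q⇒x∈p─q e∈B e∉ , j′) ◅ detour w ws j (v≢w ∘ sym) v≢ (a≢w ∘ sym) a≢ l
        where
        e∉ : e ∉ ⁅ f ⁆
        e∉ e∈ with refl ← x∈⁅y⁆⇒x≡y f e∈ with Joins-ends j j′
        ... | inj₁ (v≡u , _) = u≢v (sym v≡u)
        ... | inj₂ (v≡w , _) = v≢w v≡w

      -- Deleting the first edge `f` of a cycle does not change what is reached, because the rest of
      -- the cycle bypasses it. Hence ∣B∣ = ρ A ≤ ρ (B ─ f) ≤ ∣B ─ f∣, which is absurd.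
      acyclic : Acyclic G (rootComponent G B)
      acyclic (v ∷ [] , () , _)
      acyclic (v ∷ a ∷ [] , s≤s () , _)
      acyclic (v ∷ a ∷ c ∷ us , _ ,
               ((v≢a ∷ v≢c ∷ v≢us) ∷ (a≢c ∷ a≢us) ∷ _) ,
               ((f , (f∈B , _) , j) ∷ (e , (e∈B , _) , j′) ∷ l)) =
        ℕ.<⇒≱ (x∈p⇒∣p-x∣<∣p∣ f∈B)
          (ℕ.≤-trans (ℕ.≤-reflexive (sym size)) (ℕ.≤-trans
            (p⊆q⇒∣p∣≤∣q∣ (reached-least closed ∘ spans)) (ρ≤∣∣ (B ─ ⁅ f ⁆))))
        where
        e∉ : e ∉ ⁅ f ⁆
        e∉ e∈ with refl ← x∈⁅y⁆⇒x≡y f e∈ with Joins-ends j j′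
        ... | inj₁ (v≡a , _) = v≢a v≡a
        ... | inj₂ (v≡c , _) = v≢c v≡c
        a⇝v : Walk (B ─ ⁅ f ⁆) a v
        a⇝v = (e , x∈p∧x∉q⇒x∈p─q e∈B e∉ , j′) ◅
          detour c us j (v≢c ∘ sym) v≢us (a≢c ∘ sym) a≢us
            (Linked.map (λ (e , (e∈B , _) , j) → e , e∈B , j) l)
        closed : Closed B (reached (B ─ ⁅ f ⁆))
        closed {g} g∈B j″ u∈ with g Fin.≟ f
        ... | no  g≢f  = reached-closed (x∈p∧x≢y⇒x∈p-y g∈B g≢f) j″ u∈
        ... | yes refl with Joins-ends j j″
        ...   | inj₁ (refl , refl) = ∈ᵣreached⁺ (∈ᵣreached⁻ u∈ ◅◅ Walk-sym a⇝v)
        ...   | inj₂ (refl , refl) = ∈ᵣreached⁺ (∈ᵣreached⁻ u∈ ◅◅ a⇝v)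

    spanningTree-feasible : Feasible G B
    spanningTree-feasible = (connected , acyclic) , λ e e∈B → e∈B , λ v i →
      ∈ᵣreached⁻ (endsWithin e∈B (proj₂ (Incident⇒Joins i)))

  -- An edge of `F` outside a spanning tree `B` has both ends reached by `B`, so a simple path of
  -- `B` between them closes up to a cycle in the root component of `F`.
  feasible⇒∣∣≤ρ : ∀ {F} → Feasible G F → ∣ F ∣ ≤ ρ F
  feasible⇒∣∣≤ρ {F} ((_ , acyclic) , inComponent) with spanningTree F
  ... | B , t with Fin.any? (λ e → (e ∈? F) ×-dec ¬? (e ∈? B))
  ...   | no none = ℕ.≤-trans
    (p⊆q⇒∣p∣≤∣q∣ λ {e} e∈F → decidable-stable (e ∈? B) λ e∉B → none (e , e∈F , e∉B))
    (ℕ.≤-reflexive (sym (SpanningTree.size t)))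
  ...   | yes (e , e∈F , e∉B) = ⊥-elim (cycle (simplePath Fin._≟_ (reach v iv ◅◅ Walk-sym (reach u iu))))
    where
    open SpanningTree t
    u v : Fin #V
    u = proj₁ (ends e)
    v = proj₂ (ends e)
    iu : Incident G e u
    iu = inj₁ refl
    iv : Incident G e v
    iv = inj₂ refl
    reach : ∀ w → Incident G e w → Walk B w root
    reach w i = Walk-sym (∈ᵣreached⁻ (Sum.map₂ spans (∈ᵣreached⁺ {F} (proj₂ (inComponent e e∈F) w i))))
    lift : ∀ {a b us} → Path (Adjacent G (spanning G B)) a b us →
           Path (Adjacent G (rootComponent G F)) a b us
    lift [ a ] = [ a ]
    lift ((f , f∈B , j) ∷ p) = (f , inComponent f (edges⊆ f∈B) , j) ∷ lift p
    cycle : ¬ ∃ λ us → Path (Adjacent G (spanning G B)) v u us × Unique us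
    cycle (_ , p , unique) = helper p unique refl refl
      where
      helper : ∀ {a b us} → Path (Adjacent G (spanning G B)) a b us → Unique us → a ≡ v → b ≡ u → Empty.⊥
      -- A path without edges would make `e` a loop, and a path with one edge would be parallel to
      -- `e`; simplicity excludes both, and longer paths give cycles of length at least 3.
      helper [ _ ] _ refl v≡u = noLoops {e} (inj₁ (cong (_, v) (sym v≡u)))
      helper ((f , f∈B , j) ∷ [ _ ]) _ refl refl =
        e∉B (subst (_∈ B) (noParallel {f} {e} j (inj₂ refl)) f∈B)
      helper p@(_ ∷ _ ∷ q) unique refl refl = acyclic (_ , (2≤ q , unique ,
        path⇒linked (lift p) (e , inComponent e e∈F , inj₁ refl)))
        where
        2≤ : ∀ {R : Rel (Fin #V) 0ℓ} {a b us} → Path R a b us → 2 ≤ suc (length us)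
        2≤ [ _ ]   = s≤s (s≤s z≤n)
        2≤ (_ ∷ _) = s≤s (s≤s z≤n)

  -- A feasible F ⊆ A has ∣F∣ ≤ ρ F ≤ ρ A, and a spanning tree attains the bound.
  rank≡ρ : ∀ A → rank G A ≡ ρ A
  rank≡ρ A = ℕ.≤-antisym
    (max≤v⁺ {xs = sizes} z≤n (All.map⁺ (All.map (λ {F} → upper {F}) (All.all-filter below? (subsets #E)))))
    (v≤max⁺ 0 sizes (inj₂ (Any.map ℕ.≤-reflexive (lower (spanningTree A)))))
    where
    Below : Subset #E → Set
    Below F = F ⊆ A × Feasible G F
    below? : ∀ F → Dec (Below F)
    below? F = (F ⊆? A) ×-dec feasible? G F
    sizes : List ℕ
    sizes = map ∣_∣ (filter below? (subsets #E))
    upper : ∀ {F} → Below F → ∣ F ∣ ≤ ρ A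
    upper (F⊆A , feasible) = ℕ.≤-trans (feasible⇒∣∣≤ρ feasible) (ρ-mono F⊆A)
    lower : ∃ (SpanningTree A) → ρ A List.∈ sizes
    lower (B , t) = subst (List._∈ sizes) (sym size)
      (∈-map⁺ ∣_∣ (∈-filter⁺ below? (∈-subsets B) ((λ {e} → edges⊆ {e}) , spanningTree-feasible t)))
      where open SpanningTree t

-- Nonvanishing at x = 0 in the absence of root leaves

⊆-split-≤ : ∀ {a b a′ b′} → a ≤ b → a′ ≤ b′ → (b ℕ.+ b′) ∸ (a ℕ.+ a′) ≡ (b ∸ a) ℕ.+ (b′ ∸ a′)
⊆-split-≤ {a} {b} {a′} {b′} a≤b a′≤b′ = begin
  (b ℕ.+ b′) ∸ (a ℕ.+ a′) ≡⟨ ℕ.∸-+-assoc (b ℕ.+ b′) a a′ ⟨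
  (b ℕ.+ b′) ∸ a ∸ a′     ≡⟨ cong (_∸ a′) (ℕ.+-∸-comm b′ a≤b) ⟩
  (b ∸ a) ℕ.+ b′ ∸ a′     ≡⟨ ℕ.+-∸-assoc (b ∸ a) a′≤b′ ⟩
  (b ∸ a) ℕ.+ (b′ ∸ a′)   ∎
  where open ≡-Reasoning

t∣t^ : ∀ t {k} → 0 < k → t ∣ t ^ k
t∣t^ t {suc k} _ = ∣m⇒∣m*n (t ^ k) ∣-refl

t²∣t^ : ∀ t {k} → 1 < k → t * t ∣ t ^ k
t²∣t^ t {suc (suc k)} _ = subst (t * t ∣_) (ℤ.*-assoc t t (t ^ k)) (∣m⇒∣m*n (t ^ k) ∣-refl)
t²∣t^ t {suc zero} (s≤s ())

binomial-mod-t² : ∀ t n → t * t ∣ (1ℤ + t) ^ n - (1ℤ + (ℤ.+ n) * t)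
binomial-mod-t² t zero    = divides 0ℤ (lemma t)
  where
  lemma : ∀ t → 1ℤ - (1ℤ + 0ℤ * t) ≡ 0ℤ * (t * t)
  lemma = solve-∀
binomial-mod-t² t (suc n) with binomial-mod-t² t n
... | divides q eq = divides ((1ℤ + t) * q + ℤ.+ n) (begin
  (1ℤ + t) * b - (1ℤ + ℤ.+ suc n * t)
    ≡⟨ cong (λ m → (1ℤ + t) * b - (1ℤ + m * t)) (ℤ.pos-+ 1 n) ⟩
  (1ℤ + t) * b - (1ℤ + (1ℤ + ℤ.+ n) * t)
    ≡⟨ expand t b (ℤ.+ n) ⟩
  (1ℤ + t) * (b - (1ℤ + ℤ.+ n * t)) + ℤ.+ n * (t * t)
    ≡⟨ cong (λ z → (1ℤ + t) * z + ℤ.+ n * (t * t)) eq ⟩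
  (1ℤ + t) * (q * (t * t)) + ℤ.+ n * (t * t)
    ≡⟨ collect t q (ℤ.+ n) ⟩
  ((1ℤ + t) * q + ℤ.+ n) * (t * t) ∎)
  where
  open ≡-Reasoning
  b = (1ℤ + t) ^ n
  expand : ∀ t b n → (1ℤ + t) * b - (1ℤ + (1ℤ + n) * t) ≡ (1ℤ + t) * (b - (1ℤ + n * t)) + n * (t * t)
  expand = solve-∀
  collect : ∀ t q n → (1ℤ + t) * (q * (t * t)) + n * (t * t) ≡ ((1ℤ + t) * q + n) * (t * t)
  collect = solve-∀

binomial-mod-t : ∀ t n → t ∣ (1ℤ + t) ^ n - 1ℤ
binomial-mod-t t n = subst (t ∣_) (lemma ((1ℤ + t) ^ n) t (ℤ.+ n))
  (∣m∣n⇒∣m+n (∣-trans (∣m⇒∣m*n t ∣-refl) (binomial-mod-t² t n)) (∣n⇒∣m*n (ℤ.+ n) ∣-refl))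
  where
  lemma : ∀ b t n → (b - (1ℤ + n * t)) + n * t ≡ b - 1ℤ
  lemma = solve-∀

∤-between : ∀ {m n} → 0 < m → m < n → ¬ ℤ.+ n ∣ ℤ.+ m
∤-between {suc m} _ m<n n∣m = ℕ.<⇒≱ m<n (ℕ.∣⇒≤ (∣⇒∣ᵤ n∣m))

-1^-parity : ∀ n → -1ℤ ^ n ≡ 1ℤ ⊎ -1ℤ ^ n ≡ -1ℤ
-1^-parity zero    = inj₁ refl
-1^-parity (suc n) with -1^-parity n
... | inj₁ eq = inj₂ (cong (-1ℤ *_) eq)
... | inj₂ eq = inj₁ (cong (-1ℤ *_) eq)

-1^≢0 : ∀ n → -1ℤ ^ n ≢ 0ℤ
-1^≢0 n eq with -1^-parity n
... | inj₁ p with () ← trans (sym p) eq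
... | inj₂ p with () ← trans (sym p) eq

-1^-cancel : ∀ m n → -1ℤ ^ (m ℕ.+ n) ≡ -1ℤ → -1ℤ ^ m + -1ℤ ^ n ≡ 0ℤ
-1^-cancel m n odd with -1^-parity m | -1^-parity n | trans (sym (ℤ.^-distribˡ-+-* -1ℤ m n)) odd
... | inj₁ p | inj₁ q | eq with () ← trans (sym eq) (cong₂ _*_ p q)
... | inj₁ p | inj₂ q | _ = cong₂ _+_ p q
... | inj₂ p | inj₁ q | _ = cong₂ _+_ p q
... | inj₂ p | inj₂ q | eq with () ← trans (sym eq) (cong₂ _*_ p q)

∣p∣≡1⇒unique : ∀ {n} {p : Subset n} {i j} → ∣ p ∣ ≡ 1 → i ∈ p → j ∈ p → i ≡ j
∣p∣≡1⇒unique {p = p} {i} {j} eq i∈p j∈p = decidable-stable (i Fin.≟ j) λ i≢j →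
  ℕ.n≮0 (ℕ.<-≤-trans (x∈p⇒∣p-x∣<∣p∣ (x∈p∧x≢y⇒x∈p-y j∈p (i≢j ∘ sym)))
    (ℕ.≤-pred (subst (∣ p ─ ⁅ i ⁆ ∣ <_) eq (x∈p⇒∣p-x∣<∣p∣ i∈p))))

0<∣p∣ : ∀ {n} {p : Subset n} → Nonempty p → 0 < ∣ p ∣
0<∣p∣ (_ , i∈p) = ℕ.≤-<-trans z≤n (x∈p⇒∣p-x∣<∣p∣ i∈p)

0<∣p∣⇒Nonempty : ∀ {n} {p : Subset n} → 0 < ∣ p ∣ → Nonempty p
0<∣p∣⇒Nonempty {n} {p} 0< with nonempty? p
... | yes ne = ne
... | no empty with refl ← Empty-unique empty = ⊥-elim (ℕ.<⇒≢ 0< (sym (∣⊥∣≡0 n)))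

p─[p─q]≡q : ∀ {n} {p q : Subset n} → q ⊆ p → p ─ (p ─ q) ≡ q
p─[p─q]≡q {p = p} {q} q⊆p = ⊆-antisym
  (λ {i} i∈ → decidable-stable (i ∈? q) λ i∉q →
    x∈p─q⇒x∉q p _ i∈ (x∈p∧x∉q⇒x∈p─q (p─q⊆p p _ i∈) i∉q))
  (λ i∈q → x∈p∧x∉q⇒x∈p─q (q⊆p i∈q) λ i∈ → x∈p─q⇒x∉q p q i∈ i∈q)

module Nonvanishing (G : SimpleRootedGraph) where
  open SimpleRootedGraph G
  open Reach G

  -- Large enough not to divide 1, 2 or the rank of any set of edges.
  t : ℤ
  t = ℤ.+ (3 ℕ.+ #V)

  signedWeight : Subset #E → Subset #E → ℤ
  signedWeight Q A = -1ℤ ^ ρ A * t ^ ((∣ Q ∣ ∸ ∣ A ∣) ℕ.+ ρ A)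

  -- t ^ ∣ Q ∣ times the polynomial T(Γ; 0, y), up to sign, at y = 1 + 1/t.
  signedSum : Subset #E → ℤ
  signedSum Q = ∑⊆ Q (signedWeight Q)

  Joins-root⇒≢root : ∀ {e v} → Joins e root v → v ≢ root
  Joins-root⇒≢root j refl = noLoops j

  Separated-mono : ∀ {A A′ B B′} → A ⊆ A′ → B ⊆ B′ → Separated A′ B′ → Separated A B
  Separated-mono A⊆ B⊆ sep e∈A f∈B = sep (A⊆ e∈A) (B⊆ f∈B)

  Separated-sym : ∀ {A B} → Separated A B → Separated B A
  Separated-sym sep e∈ f∈ j j′ = sep f∈ e∈ j′ j

  signedSum-∪ : ∀ P Q → Disjoint P Q → Separated P Q →
                signedSum (P ∪ Q) ≡ signedSum P * signedSum Q
  signedSum-∪ P Q disjoint sep = begin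
    ∑⊆ (P ∪ Q) (signedWeight (P ∪ Q))                        ≡⟨ ∑-∪ P Q disjoint _ ⟩
    ∑⊆ P (λ A → ∑⊆ Q (λ B → signedWeight (P ∪ Q) (A ∪ B)))   ≡⟨ ∑-cong P (λ A A⊆P →
      trans (∑-cong Q λ B B⊆Q → weight-∪ A⊆P B⊆Q) (trans (∑-* Q (signedWeight P A) (signedWeight Q)) (ℤ.*-comm (signedWeight P A) (signedSum Q)))) ⟩
    ∑⊆ P (λ A → signedSum Q * signedWeight P A)              ≡⟨ ∑-* P (signedSum Q) (signedWeight P) ⟩
    signedSum Q * signedSum P                                ≡⟨ ℤ.*-comm (signedSum Q) (signedSum P) ⟩
    signedSum P * signedSum Q                                ∎
    where
    open ≡-Reasoning
    regroup : ∀ a b c d → (a * b) * (c * d) ≡ (a * c) * (b * d)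
    regroup = solve-∀
    weight-∪ : ∀ {A B} → A ⊆ P → B ⊆ Q →
               signedWeight (P ∪ Q) (A ∪ B) ≡ signedWeight P A * signedWeight Q B
    weight-∪ {A} {B} A⊆P B⊆Q = begin
      -1ℤ ^ ρ (A ∪ B) * t ^ ((∣ P ∪ Q ∣ ∸ ∣ A ∪ B ∣) ℕ.+ ρ (A ∪ B))
        ≡⟨ cong₂ (λ r s → -1ℤ ^ r * t ^ (s ℕ.+ r)) (ρ-∪ (Separated-mono A⊆P B⊆Q sep)) size ⟩
      -1ℤ ^ (ρ A ℕ.+ ρ B) * t ^ ((a ℕ.+ b) ℕ.+ (ρ A ℕ.+ ρ B))
        ≡⟨ cong₂ _*_ (ℤ.^-distribˡ-+-* -1ℤ (ρ A) (ρ B))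
             (trans (cong (t ^_) (ℕ-interchange a b (ρ A) (ρ B))) (ℤ.^-distribˡ-+-* t (a ℕ.+ ρ A) (b ℕ.+ ρ B))) ⟩
      (-1ℤ ^ ρ A * -1ℤ ^ ρ B) * (t ^ (a ℕ.+ ρ A) * t ^ (b ℕ.+ ρ B))
        ≡⟨ regroup (-1ℤ ^ ρ A) (-1ℤ ^ ρ B) (t ^ (a ℕ.+ ρ A)) (t ^ (b ℕ.+ ρ B)) ⟩
      signedWeight P A * signedWeight Q B ∎
      where
      a = ∣ P ∣ ∸ ∣ A ∣
      b = ∣ Q ∣ ∸ ∣ B ∣
      size : ∣ P ∪ Q ∣ ∸ ∣ A ∪ B ∣ ≡ a ℕ.+ b
      size = trans (cong₂ _∸_ (∣p∪q∣≡∣p∣+∣q∣ P Q disjoint)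
                              (∣p∪q∣≡∣p∣+∣q∣ A B λ i∈A i∈B → disjoint (A⊆P i∈A) (B⊆Q i∈B)))
                   (⊆-split-≤ (p⊆q⇒∣p∣≤∣q∣ A⊆P) (p⊆q⇒∣p∣≤∣q∣ B⊆Q))

  -- Root leaves and irreducibility relative to an edge set

  IsLeaf : Subset #E → Fin #E → Fin #V → Set
  IsLeaf Q e v = e ∈ Q × Joins e root v × (∀ {f u} → f ∈ Q → Joins f u v → f ≡ e)

  Leafless : Subset #E → Set
  Leafless Q = ∀ {e v} → ¬ IsLeaf Q e v

  -- Restricting to `P` creates no leaf: a lost edge at the end `v` of `e` would lie in `Q ─ P` and
  -- meet `e` at the non-root vertex `v`.
  Leafless-separated : ∀ {P Q} → P ⊆ Q → Separated P (Q ─ P) → Leafless Q → Leafless P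
  Leafless-separated {P} P⊆Q sep leafless {e} {v} (e∈P , j , only) = leafless (P⊆Q e∈P , j , only′)
    where
    only′ : ∀ {f u} → f ∈ _ → Joins f u v → f ≡ e
    only′ {f} f∈Q j′ with f ∈? P
    ... | yes f∈P = only f∈P j′
    ... | no  f∉P = ⊥-elim (Joins-root⇒≢root j (sep e∈P (x∈p∧x∉q⇒x∈p─q f∈Q f∉P) j j′))

  separated? : ∀ A B → Dec (Separated A B)
  separated? A B = map′
    (λ none {e} {f} {u} {w} {v} e∈ f∈ j j′ → decidable-stable (v Fin.≟ root) λ v≢r →
      none (e , f , u , w , v , e∈ , f∈ , j , j′ , v≢r))
    (λ sep (e , f , u , w , v , e∈ , f∈ , j , j′ , v≢r) → v≢r (sep e∈ f∈ j j′))
    (¬? (Fin.any? λ e → Fin.any? λ f → Fin.any? λ u → Fin.any? λ w → Fin.any? λ v →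
      (e ∈? A) ×-dec ((f ∈? B) ×-dec (joins? G e u v ×-dec (joins? G f w v ×-dec ¬? (v Fin.≟ root))))))

  Splits : Subset #E → Subset #E → Set
  Splits Q P = P ⊆ Q × Nonempty P × Nonempty (Q ─ P) × Separated P (Q ─ P)

  Irreducible : Subset #E → Set
  Irreducible Q = ¬ ∃ (Splits Q)

  -- The edges of `Q` that touch `W` have both ends in `W` or at the root, so they meet the
  -- remaining edges only in the root. If any edge remained, they would split `Q`.
  irreducible-touching : ∀ {Q W} → Irreducible Q → root ∉ W →
    (∀ {e u v} → e ∈ Q → Joins e u v → u ∈ W → v ∈ᵣ W) →
    (∃ λ e → ∃₂ λ u v → e ∈ Q × Joins e u v × v ∈ W) →
    ∀ {e} → e ∈ Q → ∃₂ λ u v → Joins e u v × v ∈ W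
  irreducible-touching {Q} {W} irreducible r∉W closed (e₀ , u₀ , v₀ , e₀∈Q , j₀ , v₀∈W) {e} e∈Q
    = decidable-stable (touching? e) λ ¬touching → irreducible
      (P , (λ i∈ → proj₁ (∈P⁻ i∈)) , (e₀ , ∈P⁺ e₀∈Q (u₀ , v₀ , j₀ , v₀∈W))
         , (e , x∈p∧x∉q⇒x∈p─q e∈Q (¬touching ∘ proj₂ ∘ ∈P⁻)) , separated)
    where
    Touching : Fin #E → Set
    Touching e = ∃₂ λ u v → Joins e u v × v ∈ W
    touching? : ∀ e → Dec (Touching e)
    touching? e = Fin.any? λ u → Fin.any? λ v → joins? G e u v ×-dec (v ∈? W)
    P? : ∀ e → Dec (e ∈ Q × Touching e)
    P? e = (e ∈? Q) ×-dec touching? e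
    P : Subset #E
    P = ⟦ P? ⟧
    ∈P⁻ : ∀ {e} → e ∈ P → e ∈ Q × Touching e
    ∈P⁻ = ∈⟦⟧⁻ P?
    ∈P⁺ : ∀ {e} → e ∈ Q → Touching e → e ∈ P
    ∈P⁺ e∈Q touching = ∈⟦⟧⁺ P? (e∈Q , touching)
    separated : Separated P (Q ─ P)
    separated {e} {f} {u} {w} {v} e∈P f∈ j j′ with ∈P⁻ e∈P
    ... | e∈Q , a , b , j″ , b∈W = helper v∈W
      where
      v∈W : v ∈ᵣ W
      v∈W with Joins-ends j j″
      ... | inj₁ (_ , refl) = inj₂ b∈W
      ... | inj₂ (_ , refl) = closed e∈Q (Joins-sym j″) b∈W
      helper : v ∈ᵣ W → v ≡ root
      helper (inj₁ v≡r) = v≡r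
      helper (inj₂ v∈W) = ⊥-elim (x∈p─q⇒x∉q Q P f∈ (∈P⁺ (p─q⊆p Q P f∈) (w , v , j′ , v∈W)))

  RootEdge : Fin #E → Set
  RootEdge e = ∃ (Joins e root)

  rootEdge? : ∀ e → Dec (RootEdge e)
  rootEdge? e = Fin.any? (joins? G e root)

  abstract

    rootEdges : Subset #E
    rootEdges = ⟦ rootEdge? ⟧

    ∈rootEdges⁺ : ∀ {e} → RootEdge e → e ∈ rootEdges
    ∈rootEdges⁺ = ∈⟦⟧⁺ rootEdge?

    ∈rootEdges⁻ : ∀ {e} → e ∈ rootEdges → RootEdge e
    ∈rootEdges⁻ = ∈⟦⟧⁻ rootEdge?

  -- The signed sum of an irreducible edge set

  module Split (Q : Subset #E) where

    -- Taking `R` as the complement of `N` in `Q` makes `N ∪ R ≡ Q` an instance of `q∪p─q≡p`.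
    N R : Subset #E
    N = Q ─ rootEdges
    R = Q ─ N

    N⊆Q : N ⊆ Q
    N⊆Q = p─q⊆p Q _

    R⊆Q : R ⊆ Q
    R⊆Q = p─q⊆p Q N

    N-nonroot : ∀ {e v} → e ∈ N → ¬ Joins e root v
    N-nonroot e∈N j = x∈p─q⇒x∉q Q _ e∈N (∈rootEdges⁺ (_ , j))

    R-root : ∀ {e} → e ∈ R → RootEdge e
    R-root {e} e∈R = decidable-stable (rootEdge? e) λ ¬root →
      x∈p─q⇒x∉q Q N e∈R (x∈p∧x∉q⇒x∈p─q (R⊆Q e∈R) (¬root ∘ ∈rootEdges⁻))

    N∪R≡Q : N ∪ R ≡ Q
    N∪R≡Q = q∪p─q≡p N⊆Q

    N-R-disjoint : Disjoint N R
    N-R-disjoint e∈N e∈R = x∈p─q⇒x∉q Q N e∈R e∈N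

    R-joins : ∀ {e u v} → e ∈ R → Joins e u v → v ≢ root → u ≡ root
    R-joins e∈R j v≢r with R-root e∈R
    ... | _ , j′ with Joins-ends j j′
    ...   | inj₁ (u≡r , _) = u≡r
    ...   | inj₂ (_ , v≡r) = ⊥-elim (v≢r v≡r)

    reachedR⁻ : ∀ {C v} → C ⊆ R → v ∈ reached C → ∃ λ e → e ∈ C × Joins e root v
    reachedR⁻ C⊆R v∈ with reached⇒touched v∈
    ... | e , _ , e∈C , j with refl ← R-joins (C⊆R e∈C) j (reached-≢root v∈) = e , e∈C , j

    reachedR⁺ : ∀ {C e v} → e ∈ C → Joins e root v → v ∈ reached C
    reachedR⁺ e∈C j = ∈reached⁺ (Joins-root⇒≢root j) ((_ , e∈C , j) ◅ ε)

    -- Distinct root edges have distinct far ends, because there are no parallel edges.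
    ρ-R : ∀ {C} → C ⊆ R → ρ C ≡ ∣ C ∣
    ρ-R {C} C⊆R = ℕ.≤-antisym (ρ≤∣∣ C)
      (∣∣-injection C (reached C) (λ e v → Joins e root v)
        (λ e∈C → let v , j = R-root (C⊆R e∈C) in v , reachedR⁺ e∈C j , j) noParallel)

    ∣C∣≤ρ : ∀ M {C} → C ⊆ R → ∣ C ∣ ≤ ρ (M ∪ C)
    ∣C∣≤ρ M {C} C⊆R = ℕ.≤-trans (ℕ.≤-reflexive (sym (ρ-R C⊆R))) (ρ-mono (q⊆p∪q M C))

    -- What is left of `signedWeight` once t ^ ∣R∣ and t ^ (∣N∣ - ∣M∣) are taken out. By `∣C∣≤ρ` the
    -- subtraction is exact, and modulo `t` only the tight `C`, with ρ (M ∪ C) = ∣C∣, survive.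
    weight : Subset #E → Subset #E → ℤ
    weight M C = -1ℤ ^ ρ (M ∪ C) * t ^ (ρ (M ∪ C) ∸ ∣ C ∣)

    inner : Subset #E → ℤ
    inner M = ∑⊆ R (weight M)

    outer : ℤ
    outer = ∑⊆ N (λ M → t ^ (∣ N ∣ ∸ ∣ M ∣) * inner M)

    signedSum-outer : signedSum Q ≡ t ^ ∣ R ∣ * outer
    signedSum-outer = begin
      ∑⊆ Q (signedWeight Q)                          ≡⟨ cong (λ P → ∑⊆ P (signedWeight Q)) N∪R≡Q ⟨
      ∑⊆ (N ∪ R) (signedWeight Q)                    ≡⟨ ∑-∪ N R N-R-disjoint _ ⟩
      ∑⊆ N (λ M → ∑⊆ R (λ C → signedWeight Q (M ∪ C)))
        ≡⟨ (∑-cong N λ M M⊆N → trans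
              (∑-cong R λ C C⊆R → trans (split M⊆N C⊆R)
                (regroup (-1ℤ ^ ρ (M ∪ C)) (t ^ ∣ R ∣) (t ^ (∣ N ∣ ∸ ∣ M ∣)) (t ^ (ρ (M ∪ C) ∸ ∣ C ∣))))
              (trans (∑-* R (t ^ ∣ R ∣ * t ^ (∣ N ∣ ∸ ∣ M ∣)) (weight M)) (ℤ.*-assoc (t ^ ∣ R ∣) (t ^ (∣ N ∣ ∸ ∣ M ∣)) (inner M)))) ⟩
      ∑⊆ N (λ M → t ^ ∣ R ∣ * (t ^ (∣ N ∣ ∸ ∣ M ∣) * inner M)) ≡⟨ ∑-* N (t ^ ∣ R ∣) (λ M → t ^ (∣ N ∣ ∸ ∣ M ∣) * inner M) ⟩
      t ^ ∣ R ∣ * outer                              ∎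
      where
      open ≡-Reasoning
      regroup : ∀ s a b c → s * (a * (b * c)) ≡ (a * b) * (s * c)
      regroup = solve-∀
      split : ∀ {M C} → M ⊆ N → C ⊆ R → signedWeight Q (M ∪ C) ≡
              -1ℤ ^ ρ (M ∪ C) * (t ^ ∣ R ∣ * (t ^ (∣ N ∣ ∸ ∣ M ∣) * t ^ (ρ (M ∪ C) ∸ ∣ C ∣)))
      split {M} {C} M⊆N C⊆R = cong (-1ℤ ^ r *_) (begin
        t ^ ((∣ Q ∣ ∸ ∣ M ∪ C ∣) ℕ.+ r) ≡⟨ cong (t ^_) exponent ⟩
        t ^ (∣ R ∣ ℕ.+ (n ℕ.+ s))       ≡⟨ ℤ.^-distribˡ-+-* t ∣ R ∣ (n ℕ.+ s) ⟩
        t ^ ∣ R ∣ * t ^ (n ℕ.+ s)       ≡⟨ cong (t ^ ∣ R ∣ *_) (ℤ.^-distribˡ-+-* t n s) ⟩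
        t ^ ∣ R ∣ * (t ^ n * t ^ s)     ∎)
        where
        c r n s : ℕ
        c = ∣ C ∣
        r = ρ (M ∪ C)
        n = ∣ N ∣ ∸ ∣ M ∣
        s = r ∸ c
        c≤R : c ≤ ∣ R ∣
        c≤R = p⊆q⇒∣p∣≤∣q∣ C⊆R
        exponent : (∣ Q ∣ ∸ ∣ M ∪ C ∣) ℕ.+ r ≡ ∣ R ∣ ℕ.+ (n ℕ.+ s)
        exponent = begin
          (∣ Q ∣ ∸ ∣ M ∪ C ∣) ℕ.+ r
            ≡⟨ cong₂ (λ p q → (p ∸ q) ℕ.+ r)
                 (trans (cong ∣_∣ (sym N∪R≡Q)) (∣p∪q∣≡∣p∣+∣q∣ N R N-R-disjoint))
                 (∣p∪q∣≡∣p∣+∣q∣ M C λ e∈M e∈C → N-R-disjoint (M⊆N e∈M) (C⊆R e∈C)) ⟩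
          (∣ N ∣ ℕ.+ ∣ R ∣ ∸ (∣ M ∣ ℕ.+ c)) ℕ.+ r
            ≡⟨ cong (ℕ._+ r) (⊆-split-≤ (p⊆q⇒∣p∣≤∣q∣ M⊆N) c≤R) ⟩
          (n ℕ.+ (∣ R ∣ ∸ c)) ℕ.+ r
            ≡⟨ cong ((n ℕ.+ (∣ R ∣ ∸ c)) ℕ.+_) (ℕ.m+[n∸m]≡n (∣C∣≤ρ M C⊆R)) ⟨
          (n ℕ.+ (∣ R ∣ ∸ c)) ℕ.+ (c ℕ.+ s)
            ≡⟨ ℕ-rearrange n (∣ R ∣ ∸ c) c s ⟩
          (c ℕ.+ (∣ R ∣ ∸ c)) ℕ.+ (n ℕ.+ s)
            ≡⟨ cong (ℕ._+ (n ℕ.+ s)) (ℕ.m+[n∸m]≡n c≤R) ⟩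
          ∣ R ∣ ℕ.+ (n ℕ.+ s) ∎
          where
          ℕ-rearrange : ∀ a b c d → (a ℕ.+ b) ℕ.+ (c ℕ.+ d) ≡ (c ℕ.+ b) ℕ.+ (a ℕ.+ d)
          ℕ-rearrange a b c d = trans (cong (ℕ._+ (c ℕ.+ d)) (ℕ.+-comm a b)) (trans (ℕ-interchange b a c d)
            (cong (ℕ._+ (a ℕ.+ d)) (ℕ.+-comm b c)))

    outer≡inner-N : ∀ {d} → (∀ M → M ⊆ N → M ≢ N → d ∣ t ^ (∣ N ∣ ∸ ∣ M ∣) * inner M) →
                    d ∣ outer - inner N
    outer≡inner-N {d} d∣ = subst (λ i → d ∣ outer - i)
      (trans (cong (λ k → t ^ k * inner N) (ℕ.n∸n≡0 ∣ N ∣)) (ℤ.*-identityˡ (inner N)))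
      (∑-largest N (λ M → t ^ (∣ N ∣ ∸ ∣ M ∣) * inner M) d∣)

    0<∣N∣∸∣M∣ : ∀ {M} → M ⊆ N → M ≢ N → 0 < ∣ N ∣ ∸ ∣ M ∣
    0<∣N∣∸∣M∣ M⊆N M≢N = ℕ.m<n⇒0<n∸m (ℕ.≰⇒> (M≢N ∘ p⊆q∧∣q∣≤∣p∣⇒p≡q M⊆N))

    module _ (irreducible : Irreducible Q) where

      -- From the reached set `W` of `N ∪ C`, edges of `N` stay in `W` and root edges return to the
      -- root, so by irreducibility every edge of `Q` touches `W`. For a root edge this puts its far
      -- end in `W`, and `W` is closed under `Q`.
      reached-N∪C : ∀ {C} → C ⊆ R → Nonempty C → reached (N ∪ C) ≡ reached Q
      reached-N∪C {C} C⊆R (e₀ , e₀∈C) = ⊆-antisym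
        (reached-mono (∪-lub N⊆Q (R⊆Q ∘ C⊆R))) (reached-least closed)
        where
        W : Subset #V
        W = reached (N ∪ C)
        W-closed : ∀ {e u v} → e ∈ Q → Joins e u v → u ∈ W → v ∈ᵣ W
        W-closed {e} {v = v} e∈Q j u∈W with e ∈? N
        ... | yes e∈N = reached-closed (p⊆p∪q C e∈N) j (inj₂ u∈W)
        ... | no  e∉N = inj₁ (R-joins (x∈p∧x∉q⇒x∈p─q e∈Q e∉N) (Joins-sym j) (reached-≢root u∈W))
        touching : ∀ {e} → e ∈ Q → ∃₂ λ u v → Joins e u v × v ∈ W
        touching = irreducible-touching irreducible (λ r∈ → reached-≢root r∈ refl) W-closed
          (let v₀ , j₀ = R-root (C⊆R e₀∈C) in
           e₀ , root , v₀ , R⊆Q (C⊆R e₀∈C) , j₀ , reachedR⁺ (q⊆p∪q N C e₀∈C) j₀)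
        closed : Closed Q W
        closed e∈Q j (inj₂ u∈W)  = W-closed e∈Q j u∈W
        closed e∈Q j (inj₁ refl) with touching e∈Q
        ... | _ , x , j′ , x∈W with Joins-ends j j′
        ...   | inj₁ (_ , refl) = inj₂ x∈W
        ...   | inj₂ (r≡x , _)  = ⊥-elim (reached-≢root x∈W (sym r≡x))

      weight-⊥ : weight N ⊥ ≡ 1ℤ
      weight-⊥ = cong₂ (λ r c → -1ℤ ^ r * t ^ (r ∸ c)) ρ≡0 (∣⊥∣≡0 #E)
        where
        ρ≡0 : ρ (N ∪ ⊥) ≡ 0
        ρ≡0 = trans (cong ∣_∣ (⊆-antisym (reached-least {W = ⊥} closed) (⊆-min _))) (∣⊥∣≡0 #V)
          where
          closed : Closed (N ∪ ⊥) ⊥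
          closed e∈ j (inj₂ u∈⊥) = ⊥-elim (∉⊥ u∈⊥)
          closed e∈ j (inj₁ refl) with x∈p∪q⁻ N ⊥ e∈
          ... | inj₁ e∈N = ⊥-elim (N-nonroot e∈N j)
          ... | inj₂ e∈⊥ = ⊥-elim (∉⊥ e∈⊥)

      weight-nonempty : ∀ C → C ⊆ R → Nonempty C → weight N C ≡ -1ℤ ^ ρ Q * t ^ (ρ Q ∸ ∣ C ∣)
      weight-nonempty C C⊆R ne =
        cong (λ W → -1ℤ ^ ∣ W ∣ * t ^ (∣ W ∣ ∸ ∣ C ∣)) (reached-N∪C C⊆R ne)

      ∣R∣≤ρ : ∣ R ∣ ≤ ρ Q
      ∣R∣≤ρ = ℕ.≤-trans (ℕ.≤-reflexive (sym (ρ-R {R} id))) (ρ-mono R⊆Q)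

      t∣outer-inner : t ∣ outer - inner N
      t∣outer-inner = outer≡inner-N λ M M⊆N M≢N →
        ∣m⇒∣m*n (inner M) (t∣t^ t (0<∣N∣∸∣M∣ M⊆N M≢N))

      -- If `outer` vanished, `t` would divide both `inner N` and `inner N - m`, hence `m`, although
      -- 0 < m < 3 ≤ t.
      outer≢0-by : ∀ {m} → 0 < m → m < 3 → t ∣ inner N - ℤ.+ m → outer ≢ 0ℤ
      outer≢0-by {m} 0<m m<3 t∣ outer≡0 = ∤-between 0<m (ℕ.<-≤-trans m<3 (ℕ.m≤m+n 3 #V))
        (subst (t ∣_) eq (∣m⇒∣-m (∣m∣n⇒∣m+n t∣outer-inner t∣)))
        where
        lemma : ∀ i m → - ((0ℤ - i) + (i - m)) ≡ m
        lemma = solve-∀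
        eq : - ((outer - inner N) + (inner N - ℤ.+ m)) ≡ ℤ.+ m
        eq = trans (cong (λ o → - ((o - inner N) + (inner N - ℤ.+ m))) outer≡0) (lemma (inner N) (ℤ.+ m))

      -- Only the empty `C` survives modulo `t`, with weight 1. The hypothesis covers k < n and
      -- holds vacuously for k = 0.
      outer≢0-if-deficient : (∀ C → C ⊆ R → Nonempty C → ∣ C ∣ < ρ Q) → outer ≢ 0ℤ
      outer≢0-if-deficient deficient = outer≢0-by {1} (s≤s z≤n) (s≤s (s≤s z≤n))
        (subst (λ w → t ∣ inner N - w) weight-⊥ (∑-smallest R (weight N) λ C C⊆R ne →
          subst (t ∣_) (sym (weight-nonempty C C⊆R ne))
            (∣n⇒∣m*n (-1ℤ ^ ρ Q) (t∣t^ t (ℕ.m<n⇒0<n∸m (deficient C C⊆R ne))))))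

      module Full (ρQ≡∣R∣ : ρ Q ≡ ∣ R ∣) (0<∣R∣ : 0 < ∣ R ∣) where

        reachedQ≡reachedR : reached R ≡ reached Q
        reachedQ≡reachedR = p⊆q∧∣q∣≤∣p∣⇒p≡q (reached-mono R⊆Q)
          (ℕ.≤-reflexive (trans ρQ≡∣R∣ (sym (ρ-R {R} id))))

        -- The weights follow the binomial pattern `g` except at the empty set, where nothing is
        -- reached; there the term of `g` is replaced by 1.
        inner-N : inner N ≡ 1ℤ + -1ℤ ^ ∣ R ∣ * ((1ℤ + t) ^ ∣ R ∣ - t ^ ∣ R ∣)
        inner-N = begin
          inner N                 ≡⟨ restore (inner N) (weight N ⊥) ⟩
          weight N ⊥ + (inner N - weight N ⊥)
            ≡⟨ cong₂ _+_ weight-⊥ (∑-agree-nonempty R (weight N) g λ C C⊆R ne →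
                 trans (weight-nonempty C C⊆R ne) (cong (λ n → -1ℤ ^ n * t ^ (n ∸ ∣ C ∣)) ρQ≡∣R∣)) ⟩
          1ℤ + (∑⊆ R g - g ⊥)     ≡⟨ cong (λ z → 1ℤ + z) (cong₂ _-_
            (trans (∑-* R s (λ C → t ^ (∣ R ∣ ∸ ∣ C ∣))) (cong (s *_) (∑-binomial R t)))
            (cong (λ k → s * t ^ (∣ R ∣ ∸ k)) (∣⊥∣≡0 #E))) ⟩
          1ℤ + (s * (1ℤ + t) ^ ∣ R ∣ - s * t ^ ∣ R ∣)
            ≡⟨ cong (λ z → 1ℤ + z) (factor s ((1ℤ + t) ^ ∣ R ∣) (t ^ ∣ R ∣)) ⟩
          1ℤ + s * ((1ℤ + t) ^ ∣ R ∣ - t ^ ∣ R ∣) ∎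
          where
          open ≡-Reasoning
          s : ℤ
          s = -1ℤ ^ ∣ R ∣
          g : Subset #E → ℤ
          g C = s * t ^ (∣ R ∣ ∸ ∣ C ∣)
          restore : ∀ a b → a ≡ b + (a - b)
          restore = solve-∀
          factor : ∀ s a b → s * a - s * b ≡ s * (a - b)
          factor = solve-∀

        outer≢0-if-even : -1ℤ ^ ∣ R ∣ ≡ 1ℤ → outer ≢ 0ℤ
        outer≢0-if-even even = outer≢0-by {2} (s≤s z≤n) (s≤s (s≤s (s≤s z≤n)))
          (subst (t ∣_) (sym eq) (∣m∣n⇒∣m-n (binomial-mod-t t ∣ R ∣) (t∣t^ t 0<∣R∣)))
          where
          lemma : ∀ a b → (1ℤ + 1ℤ * (a - b)) - ℤ.+ 2 ≡ (a - 1ℤ) - b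
          lemma = solve-∀
          eq : inner N - ℤ.+ 2 ≡ ((1ℤ + t) ^ ∣ R ∣ - 1ℤ) - t ^ ∣ R ∣
          eq = trans (cong (_- ℤ.+ 2) (trans inner-N
            (cong (λ s → 1ℤ + s * ((1ℤ + t) ^ ∣ R ∣ - t ^ ∣ R ∣)) even)))
            (lemma ((1ℤ + t) ^ ∣ R ∣) (t ^ ∣ R ∣))

        -- `Q` reaches only one non-root vertex `v`, so the other end of an edge at `v` is the root,
        -- giving the same edge again, or `v` itself, giving a loop.
        leaf-if-single : ∣ R ∣ ≡ 1 → ∃₂ (IsLeaf Q)
        leaf-if-single ∣R∣≡1 with 0<∣p∣⇒Nonempty 0<∣R∣
        ... | e , e∈R with R-root e∈R
        ...   | v , j = e , v , R⊆Q e∈R , j , only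
          where
          v∈Q : v ∈ reached Q
          v∈Q = reachedR⁺ (R⊆Q e∈R) j
          only : ∀ {f u} → f ∈ Q → Joins f u v → f ≡ e
          only f∈Q j′ with reached-closed f∈Q (Joins-sym j′) (inj₂ v∈Q)
          ... | inj₁ refl = noParallel j′ j
          ... | inj₂ u∈Q with refl ← ∣p∣≡1⇒unique (trans ρQ≡∣R∣ ∣R∣≡1) u∈Q v∈Q = ⊥-elim (noLoops j′)

        -- Since all vertices reached by Q are adjacent to the root, the sets that are
        -- closed under M are stable under complementation.
        tight-complement : ∀ {M C} → M ⊆ N → C ⊆ R → ρ (M ∪ C) ≤ ∣ C ∣ →
                           ρ (M ∪ (R ─ C)) ≤ ∣ R ─ C ∣
        tight-complement {M} {C} M⊆N C⊆R tight = ℕ.≤-trans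
          (p⊆q⇒∣p∣≤∣q∣ (reached-least closed)) (ρ≤∣∣ (R ─ C))
          where
          reached≡ : reached C ≡ reached (M ∪ C)
          reached≡ = p⊆q∧∣q∣≤∣p∣⇒p≡q (reached-mono (q⊆p∪q M C))
            (ℕ.≤-trans tight (ℕ.≤-reflexive (sym (ρ-R C⊆R))))
          R─C⊆R : R ─ C ⊆ R
          R─C⊆R = p─q⊆p R C
          cover : ∀ {v} → v ∈ reached Q → v ∈ reached C ⊎ v ∈ reached (R ─ C)
          cover {v} v∈Q =
            let f , f∈R , j = reachedR⁻ {R} id (subst (v ∈_) (sym reachedQ≡reachedR) v∈Q) in
            Sum.map (λ f∈C → reachedR⁺ f∈C j) (λ f∈ → reachedR⁺ f∈ j)
              (x∈p∪q⁻ C (R ─ C) (p⊆q∪p─q R C f∈R))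
          disjoint : Disjoint (reached C) (reached (R ─ C))
          disjoint u∈C u∈R─C =
            let g , g∈C , jg = reachedR⁻ C⊆R u∈C
                h , h∈R─C , jh = reachedR⁻ R─C⊆R u∈R─C
            in x∈p─q⇒x∉q R C h∈R─C (subst (_∈ C) (noParallel jg jh) g∈C)
          -- Tightness makes the set reached by `C` closed under `M`. An edge of `M` from the other
          -- side into it could be traversed backwards and would lead out of it.
          closedM : ∀ {e u v} → e ∈ M → Joins e u v → u ∈ reached (R ─ C) → v ∈ᵣ reached (R ─ C)
          closedM {u = u} {v} e∈M j u∈ = Sum.map₂ fromQ
            (reached-closed (N⊆Q (M⊆N e∈M)) j (inj₂ (reached-mono (R⊆Q ∘ R─C⊆R) u∈)))
            where
            backward : v ∈ reached C → u ∈ᵣ reached C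
            backward v∈C = Sum.map₂ (subst (u ∈_) (sym reached≡))
              (reached-closed (p⊆p∪q C e∈M) (Joins-sym j) (inj₂ (subst (v ∈_) reached≡ v∈C)))
            contra : u ∈ᵣ reached C → Empty.⊥
            contra (inj₁ u≡r) = reached-≢root u∈ u≡r
            contra (inj₂ u∈C) = disjoint u∈C u∈
            fromQ : v ∈ reached Q → v ∈ reached (R ─ C)
            fromQ v∈Q = Sum.[ (λ v∈C → ⊥-elim (contra (backward v∈C))) , id ] (cover v∈Q)
          closed : Closed (M ∪ (R ─ C)) (reached (R ─ C))
          closed e∈ j u∈ = Sum.[
            (λ e∈M → Sum.[ (λ { refl → ⊥-elim (N-nonroot (M⊆N e∈M) j) }) , closedM e∈M j ] u∈) ,
            (λ e∈R─C → reached-closed e∈R─C j u∈) ] (x∈p∪q⁻ M (R ─ C) e∈)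

        module Odd (odd : -1ℤ ^ ∣ R ∣ ≡ -1ℤ) where

          -- The tight sets C and R ─ C contribute opposite signs.
          t∣inner : ∀ M → M ⊆ N → t ∣ inner M
          t∣inner M M⊆N = ∑-complementary-pairs R (weight M) (0<∣p∣⇒Nonempty 0<∣R∣) pair
            where
            loose : ∀ C → ¬ ρ (M ∪ C) ≤ ∣ C ∣ → t ∣ weight M C
            loose C ρ≰ = ∣n⇒∣m*n (-1ℤ ^ ρ (M ∪ C)) (t∣t^ t (ℕ.m<n⇒0<n∸m (ℕ.≰⇒> ρ≰)))
            tight-weight : ∀ C → C ⊆ R → ρ (M ∪ C) ≤ ∣ C ∣ → weight M C ≡ -1ℤ ^ ∣ C ∣
            tight-weight C C⊆R tight = begin
              -1ℤ ^ ρ (M ∪ C) * t ^ (ρ (M ∪ C) ∸ ∣ C ∣)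
                ≡⟨ cong (λ r → -1ℤ ^ r * t ^ (r ∸ ∣ C ∣)) (ℕ.≤-antisym tight (∣C∣≤ρ M C⊆R)) ⟩
              -1ℤ ^ ∣ C ∣ * t ^ (∣ C ∣ ∸ ∣ C ∣) ≡⟨ cong (λ k → -1ℤ ^ ∣ C ∣ * t ^ k) (ℕ.n∸n≡0 ∣ C ∣) ⟩
              -1ℤ ^ ∣ C ∣ * 1ℤ                ≡⟨ ℤ.*-identityʳ (-1ℤ ^ ∣ C ∣) ⟩
              -1ℤ ^ ∣ C ∣                     ∎
              where open ≡-Reasoning
            pair : ∀ C → C ⊆ R → t ∣ weight M C + weight M (R ─ C)
            pair C C⊆R with ρ (M ∪ C) ℕ.≤? ∣ C ∣
            ... | no loose-C = ∣m∣n⇒∣m+n (loose C loose-C) (loose (R ─ C) λ tight → loose-C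
              (subst (λ C → ρ (M ∪ C) ≤ ∣ C ∣) (p─[p─q]≡q C⊆R) (tight-complement M⊆N (p─q⊆p R C) tight)))
            ... | yes tight = divides 0ℤ (trans
              (cong₂ _+_ (tight-weight C C⊆R tight)
                         (tight-weight (R ─ C) (p─q⊆p R C) (tight-complement M⊆N C⊆R tight)))
              (-1^-cancel ∣ C ∣ ∣ R ─ C ∣
                (trans (cong (-1ℤ ^_) (∣q∣+∣p─q∣≡∣p∣ C⊆R)) odd)))

          -- For M ≠ N a missing edge of `N` supplies one factor `t` and `t∣inner` supplies the
          -- other.
          t²∣outer-inner : t * t ∣ outer - inner N
          t²∣outer-inner = outer≡inner-N λ M M⊆N M≢N → ∣-trans
            (*-monoˡ-∣ t (t∣t^ t (0<∣N∣∸∣M∣ M⊆N M≢N)))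
            (*-monoʳ-∣ (t ^ (∣ N ∣ ∸ ∣ M ∣)) (t∣inner M M⊆N))

          -- With t ^ ∣R∣ divisible by t², everything but ∣R∣ t cancels modulo t². Then `t` would
          -- divide ∣R∣, although 0 < ∣R∣ = ρ Q ≤ #V < t.
          outer≢0-if-odd : 1 < ∣ R ∣ → outer ≢ 0ℤ
          outer≢0-if-odd 1<∣R∣ outer≡0 = ∤-between 0<∣R∣
            (ℕ.≤-<-trans (ℕ.≤-trans (ℕ.≤-reflexive (sym ρQ≡∣R∣)) (∣p∣≤n (reached Q))) (ℕ.m<n+m #V {3} (s≤s z≤n)))
            (*-cancelʳ-∣ t (subst (t * t ∣_) eq
              (∣m∣n⇒∣m+n (∣m∣n⇒∣m-n (t²∣t^ t 1<∣R∣) (binomial-mod-t² t ∣ R ∣)) t²∣outer-inner)))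
            where
            lemma : ∀ p b r → (p - (b - (1ℤ + r))) + (0ℤ - (1ℤ + -1ℤ * (b - p))) ≡ r
            lemma = solve-∀
            eq : (t ^ ∣ R ∣ - ((1ℤ + t) ^ ∣ R ∣ - (1ℤ + ℤ.+ ∣ R ∣ * t))) + (outer - inner N) ≡ ℤ.+ ∣ R ∣ * t
            eq = trans
              (cong ((t ^ ∣ R ∣ - ((1ℤ + t) ^ ∣ R ∣ - (1ℤ + ℤ.+ ∣ R ∣ * t))) +_) (cong₂ _-_ outer≡0
                (trans inner-N (cong (λ s → 1ℤ + s * ((1ℤ + t) ^ ∣ R ∣ - t ^ ∣ R ∣)) odd))))
              (lemma (t ^ ∣ R ∣) ((1ℤ + t) ^ ∣ R ∣) (ℤ.+ ∣ R ∣ * t))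

      outer≢0 : Leafless Q → outer ≢ 0ℤ
      outer≢0 leafless with ∣ R ∣ ℕ.<? ρ Q | ∣ R ∣ in eq
      ... | yes R<ρ | _ = outer≢0-if-deficient λ C C⊆R _ → ℕ.≤-<-trans (p⊆q⇒∣p∣≤∣q∣ C⊆R) R<ρ
      ... | no _ | zero = outer≢0-if-deficient λ C C⊆R (e , e∈C) →
        ⊥-elim (ℕ.<⇒≢ (0<∣p∣ (e , C⊆R e∈C)) (sym eq))
      ... | no R≮ρ | suc k = full k eq
        where
        full : ∀ k → ∣ R ∣ ≡ suc k → outer ≢ 0ℤ
        full k ∣R∣≡ = by-parity k ∣R∣≡ (-1^-parity ∣ R ∣)
          where
          open Full (ℕ.≤-antisym (ℕ.≮⇒≥ R≮ρ) ∣R∣≤ρ) (ℕ.≤-trans (s≤s z≤n) (ℕ.≤-reflexive (sym ∣R∣≡)))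
          by-parity : ∀ k → ∣ R ∣ ≡ suc k → -1ℤ ^ ∣ R ∣ ≡ 1ℤ ⊎ -1ℤ ^ ∣ R ∣ ≡ -1ℤ → outer ≢ 0ℤ
          by-parity k       ∣R∣≡ (inj₁ even) = outer≢0-if-even even
          by-parity zero    ∣R∣≡ (inj₂ odd)  = ⊥-elim (leafless (proj₂ (proj₂ (leaf-if-single ∣R∣≡))))
          by-parity (suc k) ∣R∣≡ (inj₂ odd)  =
            Odd.outer≢0-if-odd odd (ℕ.≤-trans (s≤s (s≤s z≤n)) (ℕ.≤-reflexive (sym ∣R∣≡)))

  -- Reduction to irreducible edge sets

  splits? : ∀ Q P → Dec (Splits Q P)
  splits? Q P = (P ⊆? Q) ×-dec (nonempty? P ×-dec (nonempty? (Q ─ P) ×-dec separated? P (Q ─ P)))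

  product≢0 : ∀ {a b} → a ≢ 0ℤ → b ≢ 0ℤ → a * b ≢ 0ℤ
  product≢0 {a} a≢0 b≢0 ab≡0 with ℤ.i*j≡0⇒i≡0∨j≡0 a ab≡0
  ... | inj₁ a≡0 = a≢0 a≡0
  ... | inj₂ b≡0 = b≢0 b≡0

  -- Strong induction on ∣Q∣: both sides of a splitting are nonempty, hence strictly smaller than
  -- `Q`, and both inherit leaflessness.
  signedSum≢0 : ∀ Q → Leafless Q → signedSum Q ≢ 0ℤ
  signedSum≢0 Q = go Q (<-wellFounded ∣ Q ∣)
    where
    go : ∀ Q → Acc _<_ ∣ Q ∣ → Leafless Q → signedSum Q ≢ 0ℤ
    go Q (acc rec) leafless with anySubset? (splits? Q)
    ... | no irreducible = subst (_≢ 0ℤ) (sym signedSum-outer)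
      (product≢0 (λ eq → case (ℤ.i^n≡0⇒i≡0 t ∣ R ∣ eq) of λ ()) (outer≢0 irreducible leafless))
      where open Split Q
    ... | yes (P , P⊆Q , (e , e∈P) , (f , f∈) , sep) = subst (_≢ 0ℤ) (sym factorisation)
      (product≢0
        (go P (rec (p⊂q⇒∣p∣<∣q∣ (P⊆Q , f , p─q⊆p Q P f∈ , x∈p─q⇒x∉q Q P f∈)))
          (Leafless-separated P⊆Q sep leafless))
        (go (Q ─ P) (rec (p∩q≢∅⇒∣p─q∣<∣p∣ Q P (e , x∈p∩q⁺ (P⊆Q e∈P , e∈P))))
          (Leafless-separated (p─q⊆p Q P)
            (subst (Separated (Q ─ P)) (sym (p─[p─q]≡q P⊆Q)) (Separated-sym sep)) leafless)))
      where
      factorisation : signedSum Q ≡ signedSum P * signedSum (Q ─ P)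
      factorisation = trans (cong signedSum (sym (q∪p─q≡p P⊆Q)))
        (signedSum-∪ P (Q ─ P) (λ i∈P i∈ → x∈p─q⇒x∉q Q P i∈ i∈P) sep)

-- Coefficients in ℤ[x , y]

module Y = Polynomial +-*-rawRing
module X = Polynomial ℤ[y]
module ℤxy where
  open RawRing ℤ[x,y] public using (rawSemiring) renaming (_+_ to _⊕_; _*_ to _⊗_; -_ to ⊖_; 0# to 𝟘; 1# to 𝟙)
  open RawSemiringDefinitions rawSemiring public using (_∣_) renaming (_^_ to _↑_)
open ℤxy hiding (_∣_)

-- The linear functional on ℤ[y] that sends y ^ j to W j.
⟨_,_⟩ : (ℕ → ℤ) → Y.Poly → ℤ
⟨ W , []    ⟩ = 0ℤ
⟨ W , a ∷ p ⟩ = a * W 0 + ⟨ W ∘ suc , p ⟩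

⟨⟩-zero : ∀ W p → (∀ j → Y.coeff p j ≡ 0ℤ) → ⟨ W , p ⟩ ≡ 0ℤ
⟨⟩-zero W []      _  = refl
⟨⟩-zero W (a ∷ p) p≈0 = trans
  (cong₂ _+_ (trans (cong (_* W 0) (p≈0 0)) (ℤ.*-zeroˡ (W 0))) (⟨⟩-zero (W ∘ suc) p (p≈0 ∘ suc))) refl

⟨⟩-resp-≈ : ∀ W p q → (∀ j → Y.coeff p j ≡ Y.coeff q j) → ⟨ W , p ⟩ ≡ ⟨ W , q ⟩
⟨⟩-resp-≈ W []      q       p≈q = sym (⟨⟩-zero W q (sym ∘ p≈q))
⟨⟩-resp-≈ W (a ∷ p) []      p≈q = ⟨⟩-zero W (a ∷ p) p≈q
⟨⟩-resp-≈ W (a ∷ p) (b ∷ q) p≈q =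
  cong₂ (λ c s → c * W 0 + s) (p≈q 0) (⟨⟩-resp-≈ (W ∘ suc) p q (p≈q ∘ suc))

⟨⟩-cong : ∀ {V W} p → (∀ j → V j ≡ W j) → ⟨ V , p ⟩ ≡ ⟨ W , p ⟩
⟨⟩-cong []      V≈W = refl
⟨⟩-cong (a ∷ p) V≈W = cong₂ (λ c s → a * c + s) (V≈W 0) (⟨⟩-cong p (V≈W ∘ suc))

⟨⟩-+ˡ : ∀ V W p → ⟨ (λ j → V j + W j) , p ⟩ ≡ ⟨ V , p ⟩ + ⟨ W , p ⟩
⟨⟩-+ˡ V W []      = refl
⟨⟩-+ˡ V W (a ∷ p) = trans (cong (a * (V 0 + W 0) +_) (⟨⟩-+ˡ (V ∘ suc) (W ∘ suc) p))
  (lemma a (V 0) (W 0) ⟨ V ∘ suc , p ⟩ ⟨ W ∘ suc , p ⟩)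
  where
  lemma : ∀ a v w s t → a * (v + w) + (s + t) ≡ (a * v + s) + (a * w + t)
  lemma = solve-∀

⟨⟩-*ˡ : ∀ c W p → ⟨ (λ j → c * W j) , p ⟩ ≡ c * ⟨ W , p ⟩
⟨⟩-*ˡ c W []      = sym (ℤ.*-zeroʳ c)
⟨⟩-*ˡ c W (a ∷ p) = trans (cong (a * (c * W 0) +_) (⟨⟩-*ˡ c (W ∘ suc) p))
  (lemma a c (W 0) ⟨ W ∘ suc , p ⟩)
  where
  lemma : ∀ a c w s → a * (c * w) + c * s ≡ c * (a * w + s)
  lemma = solve-∀

⟨⟩-+ : ∀ W p q → ⟨ W , p Y.+ₚ q ⟩ ≡ ⟨ W , p ⟩ + ⟨ W , q ⟩
⟨⟩-+ W []      q       = sym (ℤ.+-identityˡ ⟨ W , q ⟩)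
⟨⟩-+ W (a ∷ p) []      = sym (ℤ.+-identityʳ ⟨ W , a ∷ p ⟩)
⟨⟩-+ W (a ∷ p) (b ∷ q) = trans (cong ((a + b) * W 0 +_) (⟨⟩-+ (W ∘ suc) p q))
  (lemma a b (W 0) ⟨ W ∘ suc , p ⟩ ⟨ W ∘ suc , q ⟩)
  where
  lemma : ∀ a b w s t → (a + b) * w + (s + t) ≡ (a * w + s) + (b * w + t)
  lemma = solve-∀

⟨⟩-scale : ∀ W c p → ⟨ W , map (c *_) p ⟩ ≡ c * ⟨ W , p ⟩
⟨⟩-scale W c []      = sym (ℤ.*-zeroʳ c)
⟨⟩-scale W c (a ∷ p) = trans (cong ((c * a) * W 0 +_) (⟨⟩-scale (W ∘ suc) c p))
  (lemma c a (W 0) ⟨ W ∘ suc , p ⟩)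
  where
  lemma : ∀ c a w s → (c * a) * w + c * s ≡ c * (a * w + s)
  lemma = solve-∀

⟨⟩-shift : ∀ W p → ⟨ W , 0ℤ ∷ p ⟩ ≡ ⟨ W ∘ suc , p ⟩
⟨⟩-shift W p = trans (cong (_+ ⟨ W ∘ suc , p ⟩) (ℤ.*-zeroˡ (W 0))) (ℤ.+-identityˡ ⟨ W ∘ suc , p ⟩)

-- On y ^ j times `q` the functional acts as its shift by `j` acts on `q`; by linearity these values
-- form a functional to be applied to `p`.
⟨⟩-* : ∀ W p q → ⟨ W , p Y.*ₚ q ⟩ ≡ ⟨ (λ j → ⟨ W ∘ (j ℕ.+_) , q ⟩) , p ⟩
⟨⟩-* W []      q = refl
⟨⟩-* W (a ∷ p) q = trans (⟨⟩-+ W (map (a *_) q) (0ℤ ∷ (p Y.*ₚ q)))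
  (cong₂ _+_ (⟨⟩-scale W a q) (trans (⟨⟩-shift W (p Y.*ₚ q)) (⟨⟩-* (W ∘ suc) p q)))

⟨⟩-const* : ∀ W a q → ⟨ W , (a ∷ []) Y.*ₚ q ⟩ ≡ a * ⟨ W , q ⟩
⟨⟩-const* W a q = trans (⟨⟩-* W (a ∷ []) q) (ℤ.+-identityʳ (a * ⟨ W , q ⟩))

δ : ℕ → ℕ → ℤ
δ zero    zero    = 1ℤ
δ zero    (suc j) = 0ℤ
δ (suc i) zero    = 0ℤ
δ (suc i) (suc j) = δ i j

-- Coefficients are functionals themselves, so an identity proved for all `W` is equality in ℤ[y].
coeff≡⟨δ⟩ : ∀ j p → Y.coeff p j ≡ ⟨ δ j , p ⟩
coeff≡⟨δ⟩ j       []      = refl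
coeff≡⟨δ⟩ zero    (a ∷ p) = sym (trans
  (cong₂ _+_ (ℤ.*-identityʳ a) (trans (⟨⟩-cong p λ j → sym (ℤ.*-zeroˡ 0ℤ)) (⟨⟩-*ˡ 0ℤ (λ _ → 0ℤ) p)))
  (trans (cong (a +_) (ℤ.*-zeroˡ ⟨ (λ _ → 0ℤ) , p ⟩)) (ℤ.+-identityʳ a)))
coeff≡⟨δ⟩ (suc j) (a ∷ p) = trans (coeff≡⟨δ⟩ j p)
  (sym (trans (cong (_+ ⟨ δ j , p ⟩) (ℤ.*-zeroʳ a)) (ℤ.+-identityˡ ⟨ δ j , p ⟩)))

-- Powers of y - 1 and of x - 1

yPower : ℕ → Y.Poly
yPower zero    = 1ℤ ∷ []
yPower (suc m) = (-1ℤ ∷ 1ℤ ∷ []) Y.*ₚ yPower m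

⟨⟩-yPower-suc : ∀ W m → ⟨ W , yPower (suc m) ⟩ ≡ ⟨ W ∘ suc , yPower m ⟩ - ⟨ W , yPower m ⟩
⟨⟩-yPower-suc W m = trans (⟨⟩-* W (-1ℤ ∷ 1ℤ ∷ []) (yPower m))
  (lemma ⟨ W , yPower m ⟩ ⟨ W ∘ suc , yPower m ⟩)
  where
  lemma : ∀ a b → -1ℤ * a + (1ℤ * b + 0ℤ) ≡ b - a
  lemma = solve-∀

-- The binomial transform: its value at `j` is the sum over i of C(j, i) w(i), which is what y ^ j =
-- (1 + (y - 1)) ^ j must be sent to if (y - 1) ^ i is sent to w(i).
antidifference : (ℕ → ℤ) → ℕ → ℤ
antidifference w zero    = w 0
antidifference w (suc j) = antidifference w j + antidifference (w ∘ suc) j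

-- Multiplication by y − 1 corresponds to the difference operator on W, and
-- the differences of antidifference w are those of w shifted.
⟨antidifference⟩-yPower : ∀ w m → ⟨ antidifference w , yPower m ⟩ ≡ w m
⟨antidifference⟩-yPower w zero    = trans (ℤ.+-identityʳ (1ℤ * w 0)) (ℤ.*-identityˡ (w 0))
⟨antidifference⟩-yPower w (suc m) = begin
  ⟨ antidifference w , yPower (suc m) ⟩ ≡⟨ ⟨⟩-yPower-suc (antidifference w) m ⟩
  ⟨ antidifference w ∘ suc , yPower m ⟩ - s
    ≡⟨ cong (_- s) (⟨⟩-+ˡ (antidifference w) (antidifference (w ∘ suc)) (yPower m)) ⟩
  (s + ⟨ antidifference (w ∘ suc) , yPower m ⟩) - s
    ≡⟨ lemma s ⟨ antidifference (w ∘ suc) , yPower m ⟩ ⟩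
  ⟨ antidifference (w ∘ suc) , yPower m ⟩ ≡⟨ ⟨antidifference⟩-yPower (w ∘ suc) m ⟩
  w (suc m) ∎
  where
  open ≡-Reasoning
  s = ⟨ antidifference w , yPower m ⟩
  lemma : ∀ a b → (a + b) - a ≡ b
  lemma = solve-∀

+ₚ-identityʳ : ∀ p → p Y.+ₚ [] ≡ p
+ₚ-identityʳ []      = refl
+ₚ-identityʳ (a ∷ p) = refl

-- Literal equality of lists, not merely up to trailing zeros, so that it can be substituted inside
-- `X.coeff`.
y-1^ : ∀ m → (y ⊕ ⊖ 𝟙) ↑ m ≡ yPower m ∷ []
y-1^ zero    = refl
y-1^ (suc m) rewrite y-1^ m = cong (_∷ []) (+ₚ-identityʳ _)

coeffₓ-+ : ∀ p q i → X.coeff (p ⊕ q) i ≡ X.coeff p i Y.+ₚ X.coeff q i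
coeffₓ-+ []      q       i       = refl
coeffₓ-+ (a ∷ p) []      i       = sym (+ₚ-identityʳ _)
coeffₓ-+ (a ∷ p) (b ∷ q) zero    = refl
coeffₓ-+ (a ∷ p) (b ∷ q) (suc i) = coeffₓ-+ p q i

coeffₓ-*-const : ∀ p c i → X.coeff (p ⊗ (c ∷ [])) i ≡ X.coeff p i Y.*ₚ c
coeffₓ-*-const []      c i       = refl
coeffₓ-*-const (a ∷ p) c zero    = +ₚ-identityʳ _
coeffₓ-*-const (a ∷ p) c (suc i) = coeffₓ-*-const p c i

⟨⟩-zero* : ∀ W a → ⟨ W , a Y.*ₚ [] ⟩ ≡ 0ℤ
⟨⟩-zero* W []      = refl
⟨⟩-zero* W (a ∷ p) = trans (⟨⟩-shift W (p Y.*ₚ [])) (⟨⟩-zero* (W ∘ suc) p)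

⟨⟩-coeffₓ-map* : ∀ W a r i → ⟨ W , X.coeff (map (a Y.*ₚ_) r) i ⟩ ≡ ⟨ W , a Y.*ₚ X.coeff r i ⟩
⟨⟩-coeffₓ-map* W a []      i       = sym (⟨⟩-zero* W a)
⟨⟩-coeffₓ-map* W a (b ∷ r) zero    = refl
⟨⟩-coeffₓ-map* W a (b ∷ r) (suc i) = ⟨⟩-coeffₓ-map* W a r i

⟨⟩-coeffₓ-∷* : ∀ W a p r i → ⟨ W , X.coeff ((a ∷ p) ⊗ r) i ⟩ ≡
               ⟨ W , a Y.*ₚ X.coeff r i ⟩ + ⟨ W , X.coeff ([] ∷ p ⊗ r) i ⟩
⟨⟩-coeffₓ-∷* W a p r i = begin
  ⟨ W , X.coeff (map (a Y.*ₚ_) r ⊕ ([] ∷ p ⊗ r)) i ⟩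
    ≡⟨ cong ⟨ W ,_⟩ (coeffₓ-+ (map (a Y.*ₚ_) r) ([] ∷ p ⊗ r) i) ⟩
  ⟨ W , X.coeff (map (a Y.*ₚ_) r) i Y.+ₚ X.coeff ([] ∷ p ⊗ r) i ⟩
    ≡⟨ ⟨⟩-+ W (X.coeff (map (a Y.*ₚ_) r) i) _ ⟩
  ⟨ W , X.coeff (map (a Y.*ₚ_) r) i ⟩ + ⟨ W , X.coeff ([] ∷ p ⊗ r) i ⟩
    ≡⟨ cong (_+ ⟨ W , X.coeff ([] ∷ p ⊗ r) i ⟩) (⟨⟩-coeffₓ-map* W a r i) ⟩
  ⟨ W , a Y.*ₚ X.coeff r i ⟩ + ⟨ W , X.coeff ([] ∷ p ⊗ r) i ⟩ ∎
  where open ≡-Reasoning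

-- The coefficient of X ^ i in (X − 1) ^ k.
binomial : ℕ → ℕ → ℤ
binomial zero    i       = δ 0 i
binomial (suc k) zero    = - binomial k zero
binomial (suc k) (suc i) = binomial k i - binomial k (suc i)

⟨⟩-coeffₓ-[x-1]^ : ∀ W k i → ⟨ W , X.coeff ((x ⊕ ⊖ 𝟙) ↑ k) i ⟩ ≡ binomial k i * W 0
⟨⟩-coeffₓ-[x-1]^ W zero    zero    = ℤ.+-identityʳ (1ℤ * W 0)
⟨⟩-coeffₓ-[x-1]^ W zero    (suc i) = refl
⟨⟩-coeffₓ-[x-1]^ W (suc k) i = trans
  (trans (⟨⟩-coeffₓ-∷* W (-1ℤ ∷ []) 𝟙 r i)
         (cong (_+ ⟨ W , X.coeff ([] ∷ 𝟙 ⊗ r) i ⟩)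
           (trans (⟨⟩-const* W -1ℤ (X.coeff r i)) (cong (-1ℤ *_) (⟨⟩-coeffₓ-[x-1]^ W k i)))))
  (rest i)
  where
  r = (x ⊕ ⊖ 𝟙) ↑ k
  rest : ∀ i → -1ℤ * (binomial k i * W 0) + ⟨ W , X.coeff ([] ∷ 𝟙 ⊗ r) i ⟩ ≡
               binomial (suc k) i * W 0
  rest zero    = lemma (binomial k 0) (W 0)
    where
    lemma : ∀ b w → -1ℤ * (b * w) + 0ℤ ≡ - b * w
    lemma = solve-∀
  rest (suc i) = trans (cong (-1ℤ * (binomial k (suc i) * W 0) +_)
      (trans (⟨⟩-coeffₓ-∷* W (1ℤ ∷ []) [] r i)
        (cong₂ _+_ (trans (⟨⟩-const* W 1ℤ (X.coeff r i)) (cong (1ℤ *_) (⟨⟩-coeffₓ-[x-1]^ W k i)))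
                   (vanish i))))
      (lemma (binomial k (suc i)) (binomial k i) (W 0))
    where
    vanish : ∀ i → ⟨ W , X.coeff ([] ∷ []) i ⟩ ≡ 0ℤ
    vanish zero    = refl
    vanish (suc i) = refl
    lemma : ∀ b c w → -1ℤ * (b * w) + (1ℤ * (c * w) + 0ℤ) ≡ (c - b) * w
    lemma = solve-∀

⟨⟩-coeffₓ-term : ∀ W k m i → ⟨ W , X.coeff ((x ⊕ ⊖ 𝟙) ↑ k ⊗ (y ⊕ ⊖ 𝟙) ↑ m) i ⟩ ≡
                 binomial k i * ⟨ W , yPower m ⟩
⟨⟩-coeffₓ-term W k m i = begin
  ⟨ W , X.coeff (p ⊗ (y ⊕ ⊖ 𝟙) ↑ m) i ⟩      ≡⟨ cong (λ q → ⟨ W , X.coeff (p ⊗ q) i ⟩) (y-1^ m) ⟩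
  ⟨ W , X.coeff (p ⊗ (yPower m ∷ [])) i ⟩    ≡⟨ cong ⟨ W ,_⟩ (coeffₓ-*-const p (yPower m) i) ⟩
  ⟨ W , X.coeff p i Y.*ₚ yPower m ⟩          ≡⟨ ⟨⟩-* W (X.coeff p i) (yPower m) ⟩
  -- The coefficients of (x - 1) ^ k are constant in y, so only the value at y ^ 0 of the new
  -- functional enters, and that is ⟨ W , yPower m ⟩.
  ⟨ _ , X.coeff p i ⟩                        ≡⟨ ⟨⟩-coeffₓ-[x-1]^ _ k i ⟩
  binomial k i * ⟨ W , yPower m ⟩            ∎
  where
  open ≡-Reasoning
  p = (x ⊕ ⊖ 𝟙) ↑ k

-- The coefficient of x ^ i in x ^ a p, by recursion instead of a truncated subtraction.
shifted : X.Poly → ℕ → ℕ → Y.Poly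
shifted p zero    i       = X.coeff p i
shifted p (suc a) zero    = []
shifted p (suc a) (suc i) = shifted p a i

shifted-< : ∀ p {a i} → i < a → shifted p a i ≡ []
shifted-< p {suc a} {zero}  _         = refl
shifted-< p {suc a} {suc i} (s≤s i<a) = shifted-< p i<a

shifted-drop : ∀ p a i → a ≤ i → shifted (drop a p) a i ≡ X.coeff p i
shifted-drop p       zero    i       _         = refl
shifted-drop []      (suc a) (suc i) (s≤s a≤i) = shifted-nil a i
  where
  shifted-nil : ∀ a i → shifted [] a i ≡ []
  shifted-nil zero    i       = refl
  shifted-nil (suc a) zero    = refl
  shifted-nil (suc a) (suc i) = shifted-nil a i
shifted-drop (b ∷ p) (suc a) (suc i) (s≤s a≤i) = shifted-drop p a i a≤i

⟨⟩-coeffₓ-x^ : ∀ W a i → ⟨ W , X.coeff (x ↑ a) i ⟩ ≡ δ a i * W 0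
⟨⟩-coeffₓ-x^ W zero    zero    = ℤ.+-identityʳ (1ℤ * W 0)
⟨⟩-coeffₓ-x^ W zero    (suc i) = refl
⟨⟩-coeffₓ-x^ W (suc a) zero    = trans (⟨⟩-coeffₓ-∷* W [] 𝟙 (x ↑ a) 0) refl
⟨⟩-coeffₓ-x^ W (suc a) (suc i) = begin
  ⟨ W , X.coeff (x ⊗ x ↑ a) (suc i) ⟩
    ≡⟨ ⟨⟩-coeffₓ-∷* W [] 𝟙 (x ↑ a) (suc i) ⟩
  0ℤ + ⟨ W , X.coeff (𝟙 ⊗ x ↑ a) i ⟩
    ≡⟨ ℤ.+-identityˡ _ ⟩
  ⟨ W , X.coeff (𝟙 ⊗ x ↑ a) i ⟩
    ≡⟨ ⟨⟩-coeffₓ-∷* W (1ℤ ∷ []) [] (x ↑ a) i ⟩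
  ⟨ W , (1ℤ ∷ []) Y.*ₚ X.coeff (x ↑ a) i ⟩ + ⟨ W , X.coeff ([] ∷ []) i ⟩
    ≡⟨ cong₂ _+_ (trans (⟨⟩-const* W 1ℤ (X.coeff (x ↑ a) i)) (cong (1ℤ *_) (⟨⟩-coeffₓ-x^ W a i)))
                 (vanish i) ⟩
  1ℤ * (δ a i * W 0) + 0ℤ ≡⟨ lemma (δ a i * W 0) ⟩
  δ a i * W 0 ∎
  where
  open ≡-Reasoning
  vanish : ∀ i → ⟨ W , X.coeff ([] ∷ []) i ⟩ ≡ 0ℤ
  vanish zero    = refl
  vanish (suc i) = refl
  lemma : ∀ b → 1ℤ * b + 0ℤ ≡ b
  lemma = solve-∀

⟨⟩-shifted-∷ : ∀ W c p a i → δ a i * ⟨ W , c ⟩ + ⟨ W , shifted p (suc a) i ⟩ ≡ ⟨ W , shifted (c ∷ p) a i ⟩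
⟨⟩-shifted-∷ W c p zero    zero    = trans (ℤ.+-identityʳ (1ℤ * ⟨ W , c ⟩)) (ℤ.*-identityˡ ⟨ W , c ⟩)
⟨⟩-shifted-∷ W c p zero    (suc i) = trans (cong (_+ ⟨ W , X.coeff p i ⟩) (ℤ.*-zeroˡ ⟨ W , c ⟩)) (ℤ.+-identityˡ _)
⟨⟩-shifted-∷ W c p (suc a) zero    = trans (ℤ.+-identityʳ (0ℤ * ⟨ W , c ⟩)) (ℤ.*-zeroˡ ⟨ W , c ⟩)
⟨⟩-shifted-∷ W c p (suc a) (suc i) = ⟨⟩-shifted-∷ W c p a i

⟨⟩-coeffₓ-*x^ : ∀ W p a i → ⟨ W , X.coeff (p ⊗ x ↑ a) i ⟩ ≡ ⟨ W , shifted p a i ⟩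
⟨⟩-coeffₓ-*x^ W [] a i = cong ⟨ W ,_⟩ (sym (shifted-[] a i))
  where
  shifted-[] : ∀ a i → shifted [] a i ≡ []
  shifted-[] zero    i       = refl
  shifted-[] (suc a) zero    = refl
  shifted-[] (suc a) (suc i) = shifted-[] a i
⟨⟩-coeffₓ-*x^ W (c ∷ p) a i = begin
  ⟨ W , X.coeff ((c ∷ p) ⊗ x ↑ a) i ⟩ ≡⟨ ⟨⟩-coeffₓ-∷* W c p (x ↑ a) i ⟩
  ⟨ W , c Y.*ₚ X.coeff (x ↑ a) i ⟩ + ⟨ W , X.coeff ([] ∷ p ⊗ x ↑ a) i ⟩
    ≡⟨ cong₂ _+_ (trans (⟨⟩-* W c (X.coeff (x ↑ a) i))
         (trans (⟨⟩-cong c λ j → trans (⟨⟩-coeffₓ-x^ (W ∘ (j ℕ.+_)) a i)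
                                       (cong (λ n → δ a i * W n) (ℕ.+-identityʳ j)))
                (⟨⟩-*ˡ (δ a i) W c)))
         (tail i) ⟩
  δ a i * ⟨ W , c ⟩ + ⟨ W , shifted p (suc a) i ⟩ ≡⟨ ⟨⟩-shifted-∷ W c p a i ⟩
  ⟨ W , shifted (c ∷ p) a i ⟩ ∎
  where
  open ≡-Reasoning
  tail : ∀ i → ⟨ W , X.coeff ([] ∷ p ⊗ x ↑ a) i ⟩ ≡ ⟨ W , shifted p (suc a) i ⟩
  tail zero    = refl
  tail (suc i) = ⟨⟩-coeffₓ-*x^ W p a i

-- Taking the functionals `δ j` in the first hypothesis shows that dropping `m` coefficients is
-- exact division. Conversely, the coefficient of x ^ m in a multiple of x ^ a with a > m is zero,
-- and one functional that does not vanish there is enough to refute it.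
isOrdₓ : ∀ p m → (∀ W i → i < m → ⟨ W , X.coeff p i ⟩ ≡ 0ℤ) →
         (∃ λ W → ⟨ W , X.coeff p m ⟩ ≢ 0ℤ) → IsOrdₓ p m
isOrdₓ p m low (V , top) = record { quotient = drop m p ; equality = quotient } , bound
  where
  quotient : (drop m p ⊗ x ↑ m) X.≈ₚ p
  quotient i j = begin
    Y.coeff (X.coeff (drop m p ⊗ x ↑ m) i) j    ≡⟨ coeff≡⟨δ⟩ j (X.coeff (drop m p ⊗ x ↑ m) i) ⟩
    ⟨ δ j , X.coeff (drop m p ⊗ x ↑ m) i ⟩      ≡⟨ ⟨⟩-coeffₓ-*x^ (δ j) (drop m p) m i ⟩
    ⟨ δ j , shifted (drop m p) m i ⟩            ≡⟨ compare (i ℕ.<? m) ⟩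
    ⟨ δ j , X.coeff p i ⟩                       ≡⟨ sym (coeff≡⟨δ⟩ j (X.coeff p i)) ⟩
    Y.coeff (X.coeff p i) j                     ∎
    where
    open ≡-Reasoning
    compare : Dec (i < m) → ⟨ δ j , shifted (drop m p) m i ⟩ ≡ ⟨ δ j , X.coeff p i ⟩
    compare (yes i<m) = trans (cong ⟨ δ j ,_⟩ (shifted-< (drop m p) i<m)) (sym (low (δ j) i i<m))
    compare (no  i≮m) = cong ⟨ δ j ,_⟩ (shifted-drop p m i (ℕ.≮⇒≥ i≮m))
  bound : ∀ a → x ↑ a ℤxy.∣ p → a ≤ m
  bound a record { quotient = q ; equality = qx^a≈p } = ℕ.≮⇒≥ λ m<a → top (begin
    ⟨ V , X.coeff p m ⟩             ≡⟨ sym (⟨⟩-resp-≈ V (X.coeff (q ⊗ x ↑ a) m) (X.coeff p m) (qx^a≈p m)) ⟩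
    ⟨ V , X.coeff (q ⊗ x ↑ a) m ⟩   ≡⟨ ⟨⟩-coeffₓ-*x^ V q a m ⟩
    ⟨ V , shifted q a m ⟩           ≡⟨ cong ⟨ V ,_⟩ (shifted-< q m<a) ⟩
    0ℤ                              ∎)
    where open ≡-Reasoning

-- Coefficients of the Tutte polynomial as sums over subsets

∑ᴸ : ∀ {A : Set} → (A → ℤ) → List A → ℤ
∑ᴸ f = foldr (λ a s → f a + s) 0ℤ

∑ᴸ-++ : ∀ {A : Set} (f : A → ℤ) as bs → ∑ᴸ f (as ++ bs) ≡ ∑ᴸ f as + ∑ᴸ f bs
∑ᴸ-++ f []       bs = sym (ℤ.+-identityˡ (∑ᴸ f bs))
∑ᴸ-++ f (a ∷ as) bs = trans (cong (f a +_) (∑ᴸ-++ f as bs)) (sym (ℤ.+-assoc (f a) (∑ᴸ f as) (∑ᴸ f bs)))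

∑ᴸ-map : ∀ {A B : Set} (f : B → ℤ) (g : A → B) as → ∑ᴸ f (map g as) ≡ ∑ᴸ (f ∘ g) as
∑ᴸ-map f g []       = refl
∑ᴸ-map f g (a ∷ as) = cong (f (g a) +_) (∑ᴸ-map f g as)

∑ᴸ-subsets : ∀ n (f : Subset n → ℤ) → ∑ᴸ f (subsets n) ≡ ∑⊆ ⊤ f
∑ᴸ-subsets zero    f = ℤ.+-identityʳ (f Vec.[])
∑ᴸ-subsets (suc n) f = trans (∑ᴸ-++ f (map (outside Vec.∷_) (subsets n)) _) (cong₂ _+_
  (trans (∑ᴸ-map f (outside Vec.∷_) (subsets n)) (∑ᴸ-subsets n (f ∘ (outside Vec.∷_))))
  (trans (∑ᴸ-map f (inside Vec.∷_) (subsets n)) (∑ᴸ-subsets n (f ∘ (inside Vec.∷_)))))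

⟨⟩-coeffₓ-sum : ∀ {A : Set} W i (f : A → X.Poly) as →
  ⟨ W , X.coeff (foldr _⊕_ 𝟘 (map f as)) i ⟩ ≡ ∑ᴸ (λ a → ⟨ W , X.coeff (f a) i ⟩) as
⟨⟩-coeffₓ-sum W i f []       = refl
⟨⟩-coeffₓ-sum W i f (a ∷ as) = trans
  (cong ⟨ W ,_⟩ (coeffₓ-+ (f a) (foldr _⊕_ 𝟘 (map f as)) i))
  (trans (⟨⟩-+ W (X.coeff (f a) i) (X.coeff (foldr _⊕_ 𝟘 (map f as)) i))
         (cong (⟨ W , X.coeff (f a) i ⟩ +_) (⟨⟩-coeffₓ-sum W i f as)))

⟨⟩-coeffₓ-tutte : ∀ G W i → ⟨ W , X.coeff (tutte G) i ⟩ ≡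
  ∑⊆ ⊤ (λ A → binomial (rank G ⊤ ∸ rank G A) i * ⟨ W , yPower (∣ A ∣ ∸ rank G A) ⟩)
⟨⟩-coeffₓ-tutte G W i = trans (⟨⟩-coeffₓ-sum W i _ (subsets #E)) (trans (∑ᴸ-subsets #E _)
  (∑-cong ⊤ λ A _ → ⟨⟩-coeffₓ-term W (rank G ⊤ ∸ rank G A) (∣ A ∣ ∸ rank G A) i))
  where open SimpleRootedGraph G

-- Removal of root leaves

∣⟦⟧∣≡length-filter : ∀ {n ℓ} {P : Pred (Fin n) ℓ} (P? : Decidable P) →
                     ∣ ⟦ P? ⟧ ∣ ≡ length (filter P? (allFin n))
∣⟦⟧∣≡length-filter {n} P? = go id
  where
  go : ∀ {m} (f : Fin m → Fin n) → ∣ Vec.tabulate (does ∘ P? ∘ f) ∣ ≡ length (filter P? (tabulate f))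
  go {zero}  f = refl
  go {suc m} f with does (P? (f zero))
  ... | true  = cong suc (go (f ∘ suc))
  ... | false = go (f ∘ suc)

module _ {A : Set} where

  length≡1⇒≡ : ∀ {as : List A} {a b} → length as ≡ 1 → a List.∈ as → b List.∈ as → a ≡ b
  length≡1⇒≡ {_ ∷ []} _ (here refl) (here refl) = refl

  unique-constant⇒length≡1 : ∀ {as : List A} {a} → Unique as → a List.∈ as →
                             (∀ {b} → b List.∈ as → b ≡ a) → length as ≡ 1
  unique-constant⇒length≡1 {_ ∷ []}    _                  _ _     = refl
  unique-constant⇒length≡1 {b ∷ c ∷ _} ((b≢c ∷ _) ∷ _) _ const =
    ⊥-elim (b≢c (trans (const (here refl)) (sym (const (there (here refl))))))

-1^-∸ : ∀ {m n} → n ≤ m → -1ℤ ^ (m ∸ n) ≡ -1ℤ ^ m * -1ℤ ^ n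
-1^-∸ {m}     z≤n             = sym (ℤ.*-identityʳ (-1ℤ ^ m))
-1^-∸ {suc m} {suc n} (s≤s n≤m) = trans (-1^-∸ n≤m) (lemma (-1ℤ ^ m) (-1ℤ ^ n))
  where
  lemma : ∀ a b → a * b ≡ (-1ℤ * a) * (-1ℤ * b)
  lemma = solve-∀

m∸[n∸o]≡[m∸n]+o : ∀ {m n o} → o ≤ n → n ≤ m → m ∸ (n ∸ o) ≡ (m ∸ n) ℕ.+ o
m∸[n∸o]≡[m∸n]+o {m} {n} {o} o≤n n≤m = begin
  m ∸ (n ∸ o)                 ≡⟨ cong (_∸ (n ∸ o)) (ℕ.m∸n+n≡m n≤m) ⟨
  (m ∸ n) ℕ.+ n ∸ (n ∸ o)     ≡⟨ ℕ.+-∸-assoc (m ∸ n) (ℕ.m∸n≤m n o) ⟩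
  (m ∸ n) ℕ.+ (n ∸ (n ∸ o))   ≡⟨ cong ((m ∸ n) ℕ.+_) (ℕ.m∸[m∸n]≡n o≤n) ⟩
  (m ∸ n) ℕ.+ o               ∎
  where open ≡-Reasoning

binomial-0 : ∀ k → binomial k 0 ≡ -1ℤ ^ k
binomial-0 zero    = refl
binomial-0 (suc k) = trans (cong -_ (binomial-0 k)) (sym (ℤ.-1*i≡-i (-1ℤ ^ k)))

module Peeling (G : SimpleRootedGraph) where
  open SimpleRootedGraph G
  open Reach G
  open Nonvanishing G

  -- The coefficient of x ^ i in T(Γ(G ∣ Q)), with w m in place of (y − 1) ^ m.
  tutteₓ : Subset #E → (ℕ → ℤ) → ℕ → ℤ
  tutteₓ Q w i = ∑⊆ Q λ A → binomial (ρ Q ∸ ρ A) i * w (∣ A ∣ ∸ ρ A)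

  module Leaf {Q : Subset #E} {e : Fin #E} {v : Fin #V} (leaf : IsLeaf Q e v) where

    private
      Q′ : Subset #E
      Q′ = Q ─ ⁅ e ⁆

      e∈Q : e ∈ Q
      e∈Q = proj₁ leaf

      e-joins : Joins e root v
      e-joins = proj₁ (proj₂ leaf)

      e-only : ∀ {f u} → f ∈ Q → Joins f u v → f ≡ e
      e-only = proj₂ (proj₂ leaf)

      Q′⊆Q : Q′ ⊆ Q
      Q′⊆Q = p─q⊆p Q ⁅ e ⁆

      e∉Q′ : e ∉ Q′
      e∉Q′ e∈ = x∈p─q⇒x∉q Q ⁅ e ⁆ e∈ (x∈⁅x⁆ e)

      ⁅e⁆⊆Q : ⁅ e ⁆ ⊆ Q
      ⁅e⁆⊆Q i∈ = subst (_∈ Q) (sym (x∈⁅y⁆⇒x≡y e i∈)) e∈Q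

      disjoint : ∀ {A} → A ⊆ Q′ → Disjoint ⁅ e ⁆ A
      disjoint A⊆Q′ i∈ i∈A = x∈p─q⇒x∉q Q ⁅ e ⁆ (A⊆Q′ i∈A) i∈

      separated : ∀ {A} → A ⊆ Q′ → Separated ⁅ e ⁆ A
      separated A⊆Q′ e∈ f∈A j j′ with refl ← x∈⁅y⁆⇒x≡y e e∈ with Joins-ends e-joins j
      ... | inj₁ (_ , refl) = ⊥-elim (e∉Q′ (subst (_∈ Q′) (e-only (Q′⊆Q (A⊆Q′ f∈A)) j′) (A⊆Q′ f∈A)))
      ... | inj₂ (r≡ , _)   = sym r≡

      ρ-e : ρ ⁅ e ⁆ ≡ 1
      ρ-e = ℕ.≤-antisym (ℕ.≤-trans (ρ≤∣∣ ⁅ e ⁆) (ℕ.≤-reflexive (∣⁅x⁆∣≡1 e)))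
        (0<∣p∣ (v , Split.reachedR⁺ Q (x∈⁅x⁆ e) e-joins))

      ρ-e∪ : ∀ {A} → A ⊆ Q′ → ρ (⁅ e ⁆ ∪ A) ≡ suc (ρ A)
      ρ-e∪ A⊆Q′ = trans (ρ-∪ (separated A⊆Q′)) (cong (ℕ._+ ρ _) ρ-e)

      ∣e∪∣ : ∀ {A} → A ⊆ Q′ → ∣ ⁅ e ⁆ ∪ A ∣ ≡ suc ∣ A ∣
      ∣e∪∣ {A} A⊆Q′ = trans (∣p∪q∣≡∣p∣+∣q∣ ⁅ e ⁆ A (disjoint A⊆Q′)) (cong (ℕ._+ ∣ A ∣) (∣⁅x⁆∣≡1 e))

      ρ-Q : ρ Q ≡ suc (ρ Q′)
      ρ-Q = trans (cong ρ (sym (q∪p─q≡p ⁅e⁆⊆Q))) (ρ-e∪ id)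

    -- Adding `e` to a set A ⊆ Q′ raises rank and size by one and keeps ∣A∣ - ρ A. Each such pair
    -- therefore contributes (x - 1) ^ (k + 1) + (x - 1) ^ k = x (x - 1) ^ k, the source of the
    -- factor x.
    tutteₓ-leaf : ∀ w i → tutteₓ Q w i ≡ ∑⊆ Q′ λ A →
      (binomial (suc (ρ Q′ ∸ ρ A)) i + binomial (ρ Q′ ∸ ρ A) i) * w (∣ A ∣ ∸ ρ A)
    tutteₓ-leaf w i = begin
      ∑⊆ Q f                                          ≡⟨ cong (λ P → ∑⊆ P f) (sym (q∪p─q≡p ⁅e⁆⊆Q)) ⟩
      ∑⊆ (⁅ e ⁆ ∪ Q′) f                               ≡⟨ ∑-∪ ⁅ e ⁆ Q′ (disjoint id) f ⟩
      ∑⊆ ⁅ e ⁆ (λ B → ∑⊆ Q′ (λ A → f (B ∪ A)))        ≡⟨ ∑-⁅⁆ e (λ B → ∑⊆ Q′ (λ A → f (B ∪ A))) ⟩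
      ∑⊆ Q′ (λ A → f (⊥ ∪ A)) + ∑⊆ Q′ (λ A → f (⁅ e ⁆ ∪ A))
        ≡⟨ sym (∑-+ Q′ (λ A → f (⊥ ∪ A)) (λ A → f (⁅ e ⁆ ∪ A))) ⟩
      ∑⊆ Q′ (λ A → f (⊥ ∪ A) + f (⁅ e ⁆ ∪ A))         ≡⟨ ∑-cong Q′ pointwise ⟩
      ∑⊆ Q′ (λ A → (binomial (suc (ρ Q′ ∸ ρ A)) i + binomial (ρ Q′ ∸ ρ A) i) * w (∣ A ∣ ∸ ρ A)) ∎
      where
      open ≡-Reasoning
      f : Subset #E → ℤ
      f A = binomial (ρ Q ∸ ρ A) i * w (∣ A ∣ ∸ ρ A)
      without : ∀ A → A ⊆ Q′ → f (⊥ ∪ A) ≡ binomial (suc (ρ Q′ ∸ ρ A)) i * w (∣ A ∣ ∸ ρ A)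
      without A A⊆Q′ = trans (cong f (∪-identityˡ A)) (cong (λ k → binomial k i * w (∣ A ∣ ∸ ρ A))
        (trans (cong (_∸ ρ A) ρ-Q) (ℕ.+-∸-assoc 1 (ρ-mono A⊆Q′))))
      with-e : ∀ A → A ⊆ Q′ → f (⁅ e ⁆ ∪ A) ≡ binomial (ρ Q′ ∸ ρ A) i * w (∣ A ∣ ∸ ρ A)
      with-e A A⊆Q′ = cong₂ (λ k m → binomial k i * w m)
        (cong₂ _∸_ ρ-Q (ρ-e∪ A⊆Q′)) (cong₂ _∸_ (∣e∪∣ A⊆Q′) (ρ-e∪ A⊆Q′))
      pointwise : ∀ A → A ⊆ Q′ → f (⊥ ∪ A) + f (⁅ e ⁆ ∪ A) ≡
        (binomial (suc (ρ Q′ ∸ ρ A)) i + binomial (ρ Q′ ∸ ρ A) i) * w (∣ A ∣ ∸ ρ A)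
      pointwise A A⊆Q′ = trans (cong₂ _+_ (without A A⊆Q′) (with-e A A⊆Q′))
        (sym (ℤ.*-distribʳ-+ (w (∣ A ∣ ∸ ρ A)) (binomial (suc (ρ Q′ ∸ ρ A)) i) (binomial (ρ Q′ ∸ ρ A) i)))

    tutteₓ-leaf-zero : ∀ w → tutteₓ Q w 0 ≡ 0ℤ
    tutteₓ-leaf-zero w = trans (tutteₓ-leaf w 0) (trans
      (∑-cong Q′ λ A _ → trans
        (cong (_* w (∣ A ∣ ∸ ρ A)) (ℤ.+-inverseˡ (binomial (ρ Q′ ∸ ρ A) 0)))
        (ℤ.*-zeroˡ (w (∣ A ∣ ∸ ρ A))))
      (trans (∑-* Q′ 0ℤ (λ _ → 0ℤ)) (ℤ.*-zeroˡ (∑⊆ Q′ (λ _ → 0ℤ)))))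

    tutteₓ-leaf-suc : ∀ w i → tutteₓ Q w (suc i) ≡ tutteₓ Q′ w i
    tutteₓ-leaf-suc w i = trans (tutteₓ-leaf w (suc i)) (∑-cong Q′ λ A _ →
      cong (_* w (∣ A ∣ ∸ ρ A)) (lemma (binomial (ρ Q′ ∸ ρ A) i) (binomial (ρ Q′ ∸ ρ A) (suc i))))
      where
      lemma : ∀ a b → (a - b) + b ≡ a
      lemma = solve-∀

    leaf-remove : ∀ {f u} → u ≢ v → IsLeaf Q f u → IsLeaf Q′ f u
    leaf-remove {f} {u} u≢v (f∈Q , j , only) =
      x∈p∧x≢y⇒x∈p-y f∈Q f≢e , j , λ g∈ → only (Q′⊆Q g∈)
      where
      f≢e : f ≢ e
      f≢e refl with Joins-ends e-joins j
      ... | inj₁ (_ , v≡u) = u≢v (sym v≡u)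
      ... | inj₂ (r≡u , _) = Joins-root⇒≢root j (sym r≡u)

    -- No new leaf appears when `e` is deleted, since the only ends of `e` are the root and `v`.
    leaf-restore : ∀ {f u} → IsLeaf Q′ f u → u ≢ v × IsLeaf Q f u
    leaf-restore {f} {u} (f∈Q′ , j , only) = u≢v , Q′⊆Q f∈Q′ , j , only′
      where
      u≢v : u ≢ v
      u≢v refl = e∉Q′ (subst (_∈ Q′) (e-only (Q′⊆Q f∈Q′) j) f∈Q′)
      only′ : ∀ {g w} → g ∈ Q → Joins g w u → g ≡ f
      only′ {g} g∈Q j′ with g Fin.≟ e
      ... | no  g≢e  = only (x∈p∧x≢y⇒x∈p-y g∈Q g≢e) j′
      ... | yes refl with Joins-ends e-joins j′
      ...   | inj₁ (_ , v≡u) = ⊥-elim (u≢v (sym v≡u))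
      ...   | inj₂ (r≡u , _) = ⊥-elim (Joins-root⇒≢root j (sym r≡u))

  tutteₓ-leafless : ∀ Q → Leafless Q → ∃ λ w → tutteₓ Q w 0 ≢ 0ℤ
  tutteₓ-leafless Q leafless = w , subst (_≢ 0ℤ) (sym eq)
    (product≢0 (-1^≢0 (ρ Q)) (signedSum≢0 Q leafless))
    where
    w : ℕ → ℤ
    -- This is (1/t) ^ m multiplied by t ^ ∣Q∣. At m = ∣A∣ - ρ A the exponent becomes that of
    -- `signedWeight`.
    w m = t ^ (∣ Q ∣ ∸ m)
    eq : tutteₓ Q w 0 ≡ -1ℤ ^ ρ Q * signedSum Q
    eq = trans
      (∑-cong Q λ A A⊆Q → trans
        (cong₂ _*_ (trans (binomial-0 (ρ Q ∸ ρ A)) (-1^-∸ (ρ-mono A⊆Q)))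
                   (cong (t ^_) (m∸[n∸o]≡[m∸n]+o (ρ≤∣∣ A) (p⊆q⇒∣p∣≤∣q∣ A⊆Q))))
        (ℤ.*-assoc (-1ℤ ^ ρ Q) (-1ℤ ^ ρ A) (t ^ ((∣ Q ∣ ∸ ∣ A ∣) ℕ.+ ρ A))))
      (∑-* Q (-1ℤ ^ ρ Q) (signedWeight Q))

  LeafVertices : Subset #E → Subset #V → Set
  LeafVertices Q L = ∀ {v} → v ∈ L ⇔ ∃ λ e → IsLeaf Q e v

  -- Quantifying over arbitrary sequences `w` loses nothing, because every `w` comes from a
  -- functional through `antidifference`.
  HasOrder : Subset #E → ℕ → Set
  HasOrder Q m = (∀ w i → i < m → tutteₓ Q w i ≡ 0ℤ) × ∃ λ w → tutteₓ Q w m ≢ 0ℤ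

  -- Induction on the number of leaves: deleting one leaf edge lowers the index of every coefficient
  -- by one and removes exactly one vertex from `L`.
  hasOrder : ∀ m {Q L} → ∣ L ∣ ≡ m → LeafVertices Q L → HasOrder Q m
  hasOrder zero {Q} {L} ∣L∣≡0 leaves = (λ _ _ ()) , tutteₓ-leafless Q λ {e} {v} leaf →
    ℕ.<⇒≢ (0<∣p∣ (v , Equivalence.from leaves (e , leaf))) (sym ∣L∣≡0)
  hasOrder (suc m) {Q} {L} ∣L∣≡1+m leaves
    with v , v∈L ← 0<∣p∣⇒Nonempty {p = L} (ℕ.≤-trans (s≤s z≤n) (ℕ.≤-reflexive (sym ∣L∣≡1+m)))
    with e , leaf ← Equivalence.to leaves v∈L = low , top
    where
    open Leaf leaf
    ⁅v⁆⊆L : ⁅ v ⁆ ⊆ L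
    ⁅v⁆⊆L i∈ = subst (_∈ L) (sym (x∈⁅y⁆⇒x≡y v i∈)) v∈L
    ∣L─v∣≡m : ∣ L ─ ⁅ v ⁆ ∣ ≡ m
    ∣L─v∣≡m = ℕ.suc-injective (trans (trans (cong (ℕ._+ ∣ L ─ ⁅ v ⁆ ∣) (sym (∣⁅x⁆∣≡1 v)))
      (∣q∣+∣p─q∣≡∣p∣ ⁅v⁆⊆L)) ∣L∣≡1+m)
    leaves′ : LeafVertices (Q ─ ⁅ e ⁆) (L ─ ⁅ v ⁆)
    leaves′ {u} = mk⇔
      (λ u∈ → let f , leaf-f = Equivalence.to leaves (p─q⊆p L ⁅ v ⁆ u∈) in
        f , leaf-remove (λ { refl → x∈p─q⇒x∉q L ⁅ v ⁆ u∈ (x∈⁅x⁆ v) }) leaf-f)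
      (λ (f , leaf-f) → let u≢v , leaf-f′ = leaf-restore leaf-f in
        x∈p∧x≢y⇒x∈p-y (Equivalence.from leaves (f , leaf-f′)) u≢v)
    ih : HasOrder (Q ─ ⁅ e ⁆) m
    ih = hasOrder m ∣L─v∣≡m leaves′
    low : ∀ w i → i < suc m → tutteₓ Q w i ≡ 0ℤ
    low w zero    _         = tutteₓ-leaf-zero w
    low w (suc i) (s≤s i<m) = trans (tutteₓ-leaf-suc w i) (proj₁ ih w i i<m)
    top : ∃ λ w → tutteₓ Q w (suc m) ≢ 0ℤ
    top = let w , ≢0 = proj₂ ih in w , subst (_≢ 0ℤ) (sym (tutteₓ-leaf-suc w m)) ≢0

  rootLeaves : Subset #V
  rootLeaves = ⟦ isRootLeaf? G ⟧

  rootLeaf⇔leaf : ∀ v → IsRootLeaf G v ⇔ ∃ λ e → IsLeaf ⊤ e v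
  rootLeaf⇔leaf v = mk⇔ to from
    where
    incidentEdges : List (Fin #E)
    incidentEdges = filter (λ e → incident? G e v) (allFin #E)
    ∈incident : ∀ {e u} → Joins e u v → e List.∈ incidentEdges
    ∈incident j = ∈-filter⁺ (λ e → incident? G e v) (∈-allFin _) (Joins⇒Incident j)
    to : IsRootLeaf G v → ∃ λ e → IsLeaf ⊤ e v
    to (v≢r , (e , e∈ , j) , degree≡1) =
      e , e∈ , j , λ _ j′ → length≡1⇒≡ degree≡1 (∈incident j′) (∈incident j)
    from : (∃ λ e → IsLeaf ⊤ e v) → IsRootLeaf G v
    from (e , e∈ , j , only) = Joins-root⇒≢root j , (e , e∈ , j) ,
      unique-constant⇒length≡1 (Unique.filter⁺ (λ e → incident? G e v) (Unique.allFin⁺ #E)) (∈incident j)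
        λ f∈ → only ∈⊤ (proj₂ (Incident⇒Joins
          (proj₂ (∈-filter⁻ (λ e → incident? G e v) {xs = allFin #E} f∈))))

  rootLeaves-leaves : LeafVertices ⊤ rootLeaves
  rootLeaves-leaves {v} = mk⇔
    (Equivalence.to (rootLeaf⇔leaf v) ∘ ∈⟦⟧⁻ (isRootLeaf? G))
    (∈⟦⟧⁺ (isRootLeaf? G) ∘ Equivalence.from (rootLeaf⇔leaf v))

  ⟨⟩-coeffₓ-tutte≡tutteₓ : ∀ W i →
    ⟨ W , X.coeff (tutte G) i ⟩ ≡ tutteₓ ⊤ (λ m → ⟨ W , yPower m ⟩) i
  ⟨⟩-coeffₓ-tutte≡tutteₓ W i = trans (⟨⟩-coeffₓ-tutte G W i) (∑-cong ⊤ λ A _ →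
    cong₂ (λ r s → binomial (r ∸ s) i * ⟨ W , yPower (∣ A ∣ ∸ s) ⟩) (rank≡ρ ⊤) (rank≡ρ A))

  tutte-isOrdₓ : IsOrdₓ (tutte G) (#rootLeaves G)
  tutte-isOrdₓ = isOrdₓ (tutte G) (#rootLeaves G)
    (λ W i i<m → trans (⟨⟩-coeffₓ-tutte≡tutteₓ W i) (proj₁ order (λ m → ⟨ W , yPower m ⟩) i i<m))
    -- The sequence `w` has to be turned into values on the powers of y, because functionals are
    -- given by those and not by values on the powers of y - 1.
    (let w , ≢0 = proj₂ order in antidifference w , subst (_≢ 0ℤ)
      (sym (trans (⟨⟩-coeffₓ-tutte≡tutteₓ (antidifference w) (#rootLeaves G))
        (∑-cong ⊤ λ A _ → cong (binomial (ρ ⊤ ∸ ρ A) (#rootLeaves G) *_)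
          (⟨antidifference⟩-yPower w (∣ A ∣ ∸ ρ A))))) ≢0)
    where
    order : HasOrder ⊤ (#rootLeaves G)
    order = hasOrder (#rootLeaves G) (∣⟦⟧∣≡length-filter (isRootLeaf? G)) rootLeaves-leaves

theorem1p4 : (G : SimpleRootedGraph) → IsOrdₓ (tutte G) (#rootLeaves G)
theorem1p4 G = Peeling.tutte-isOrdₓ G
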